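{- Let $\mathcal{A}$ be any allocation-monotone greedy algorithm for the fractional Online Budgeted Allocation Problem. Then, on instances satisfying $b_{i,j}\le B_i$ for all $(i,j)\in E$, $\mathcal{A}$ achieves a competitive ratio of at least $\frac{e-1}{e}$ in the random order arrival model; that is, for every such instance, if the items of $R$ arrive in a uniformly random order, then the expected value of the allocation produced by $\mathcal{A}$ satisfies $$\mathbb{E}\Bigl[\sum_{(i,j)\in E}b_{i,j}x_{i,j}\Bigr]\;\ge\;\frac{e-1}{e}\cdot\mathrm{OPT},$$ where $\mathrm{OPT}$ is the maximum value of a feasible fractional allocation of the instance.
   Context: Online Budgeted Allocation Problem (OnBAP, fractional): an instance consists of a finite bipartite graph $(L\cup R,E)$, where $L$ is a set of buyers (bidders) with budgets $B_i>0$ known in advance and $R$ is a set of items arriving online one by one. When item $j$ arrives, its set of neighboring buyers $N(j)\subseteq L$ and the bids $b_{i,j}\ge 0$ for $i\in N(j)$ are revealed, and the algorithm must irrevocably choose $x_{i,j}\ge 0$ for $i\in N(j)$, maintaining feasibility. A feasible fractional allocation satisfies $x_{i,j}\ge 0$, $\sum_{j\in N(i)}b_{i,j}x_{i,j}\le B_i$ for all $i\in L$, and $\sum_{i\in N(j)}x_{i,j}\le 1$ for all $j\in R$; its value is $\sum_{(i,j)\in E}b_{i,j}x_{i,j}$. The water-level $y_i$ of $i$ at a given time is the sum of $b_{i,j}x_{i,j}$ over what has been allocated to $i$ so far; the budget of $i$ is exhausted when $y_i=B_i$. Greedy: an online fractional allocation algorithm is greedy if (1) it is not allowed to keep a positive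 fraction of the arrived item unallocated whenever allocation is possible (i.e., whenever some neighboring buyer's budget is not exhausted); and (2) while (continuously) allocating an item, it always selects a bidder with maximum bid among those neighbors of the item whose budget is not exhausted, with an arbitrary tie-breaking rule. Allocation-monotone: fix the offline side $L$ (with budgets). An input sequence $\mathbf{seq}$ is an ordered set of items, where the data associated with each element also encodes its set of offline neighbors along with the bids. Let $[\mathbf{seq},j]$ denote the concatenation of $\mathbf{seq}$ with the single-element sequence $(j)$, and let $\mathbf{y}_{\mathrm{old}}(\mathbf{seq})$ and $\mathbf{y}_{\mathrm{new}}(\mathbf{seq})$ denote the vectors of water-levels of the vertices of $L$ when the algorithm is run on $[\mathbf{seq},j]$, respectively before and after it processes $j$. The algorithm is allocation-monotone if for any two input sequences $[\mathbf{seq}_1,j]$ and $[\mathbf{seq}_2,j]$ with $\mathbf{y}_{\mathrm{old}}(\mathbf{seq}_1)\preceq \mathbf{y}_{\mathrm{old}}(\mathbf{seq}_2)$ one has $\mathbf{y}_{\mathrm{new}}(\mathbf{seq}_1)\preceq \mathbf{y}_{\mathrm{new}}(\mathbf{seq}_2)$, where $\preceq$ is element-wise comparison. An allocation-monotone greedy algorithm is one that is both greedy and allocation-monotone. -}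

module Defs where

open import Algebra.Core using (Op₁; Op₂)
open import Algebra.Bundles using (CommutativeRing)
open import Algebra.Structures using (IsCommutativeRing)
open import Data.Bool.Base using (if_then_else_)
open import Data.Fin.Base using (Fin)
open import Data.Fin.Subset using (Subset; _∈_)
open import Data.List.Base using (List; []; _∷_; map; foldr; concatMap; length; allFin)
open import Data.Nat.Base as ℕ using (ℕ; zero; suc; _!)
open import Data.Nat.Properties using (_!≢0)
open import Data.Product.Base using (∃; ∃-syntax; _×_; _,_; proj₁; proj₂)
open import Data.Sum.Base using (inj₁; inj₂)
open import Data.Vec.Base using (lookup)
open import Level using (0ℓ)
import Relation.Binary.Construct.NonStrictToStrict as NonStrictToStrict
open import Relation.Binary.Bundles using (Poset)
open import Relation.Binary.Core using (Rel)
import Relation.Binary.Reasoning.PartialOrder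
open import Relation.Binary.Structures using (IsDecTotalOrder)
open import Relation.Nullary using (¬_)
open import Relation.Nullary.Negation using (contradiction)
open import Relation.Unary using (Pred)

-- The (classical) real numbers, given axiomatically: order and equality
-- are decidable and every inhabited bounded-above predicate has a supremum.
-- The value of _⁻¹ at zero is unspecified.
record CompleteOrderedField : Set₁ where
  infix  9 _⁻¹
  infix  8 -_
  infixl 7 _*_
  infixl 6 _+_
  infix  4 _≈_ _≤_
  field
    Carrier           : Set
    _≈_               : Rel Carrier 0ℓ
    _≤_               : Rel Carrier 0ℓ
    _+_ _*_           : Op₂ Carrier
    -_ _⁻¹            : Op₁ Carrier
    0# 1#             : Carrier
    isCommutativeRing : IsCommutativeRing _≈_ _+_ _*_ -_ 0# 1#
    0#≉1#             : ¬ (0# ≈ 1#)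
    ⁻¹-inverseʳ       : ∀ x → ¬ (x ≈ 0#) → x * x ⁻¹ ≈ 1#
    isDecTotalOrder   : IsDecTotalOrder _≈_ _≤_
    +-monoʳ-≤         : ∀ z {x y} → x ≤ y → z + x ≤ z + y
    *-nonNegative     : ∀ {x y} → 0# ≤ x → 0# ≤ y → 0# ≤ x * y

  UpperBound : Pred Carrier 0ℓ → Pred Carrier 0ℓ
  UpperBound P u = ∀ x → P x → x ≤ u

  IsSupremum : Pred Carrier 0ℓ → Pred Carrier 0ℓ
  IsSupremum P s = UpperBound P s × (∀ u → UpperBound P u → s ≤ u)

  IsMaximum : Pred Carrier 0ℓ → Pred Carrier 0ℓ
  IsMaximum P s = P s × UpperBound P s

  field
    complete : ∀ (P : Pred Carrier 0ℓ) → ∃ P → ∃ (UpperBound P) → ∃ (IsSupremum P)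

  commutativeRing : CommutativeRing 0ℓ 0ℓ
  commutativeRing = record { isCommutativeRing = isCommutativeRing }

  open CommutativeRing commutativeRing public
    hiding (Carrier; _≈_; _+_; _*_; -_; 0#; 1#; isCommutativeRing)

  module ≤ = IsDecTotalOrder isDecTotalOrder

  poset : Poset 0ℓ 0ℓ 0ℓ
  poset = record { isPartialOrder = ≤.isPartialOrder }

  open NonStrictToStrict _≈_ _≤_ public using (_<_)

  open import Algebra.Properties.CommutativeMonoid.Sum +-commutativeMonoid public
    using (sum)
  open import Algebra.Properties.Semiring.Mult semiring public
    using () renaming (_×_ to _·_)

  fromℕ : ℕ → Carrier
  fromℕ n = n · 1#

  mean : List Carrier → Carrier
  mean xs = foldr _+_ 0# xs * fromℕ (length xs) ⁻¹

module Euler (ℝ : CompleteOrderedField) where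
  open CompleteOrderedField ℝ
  open import Algebra.Properties.Ring ring
    using (-‿distribˡ-*; -‿distribʳ-*; -‿involutive)
  open import Algebra.Properties.Semiring.Mult semiring
    using (×1-homo-*; ×-assoc-*)
  open Relation.Binary.Reasoning.PartialOrder poset

  1/_! : ℕ → Carrier
  1/ k ! = fromℕ (k !) ⁻¹

  -- expSum n = 1/0! + 1/1! + ⋯ + 1/(n-1)!
  expSum : ℕ → Carrier
  expSum zero    = 0#
  expSum (suc n) = expSum n + 1/ n !

  private
    +-monoˡ-≤ : ∀ z {x y} → x ≤ y → x + z ≤ y + z
    +-monoˡ-≤ z {x} {y} x≤y = begin
      x + z  ≈⟨ +-comm x z ⟩
      z + x  ≤⟨ +-monoʳ-≤ z x≤y ⟩
      z + y  ≈⟨ +-comm z y ⟩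
      y + z  ∎

    x≤x+y : ∀ x {y} → 0# ≤ y → x ≤ x + y
    x≤x+y x {y} 0≤y = begin
      x       ≈⟨ +-identityʳ x ⟨
      x + 0#  ≤⟨ +-monoʳ-≤ x 0≤y ⟩
      x + y   ∎

    neg-nonNegative : ∀ {x} → x ≤ 0# → 0# ≤ - x
    neg-nonNegative {x} x≤0 = begin
      0#        ≈⟨ -‿inverseˡ x ⟨
      - x + x   ≤⟨ +-monoʳ-≤ (- x) x≤0 ⟩
      - x + 0#  ≈⟨ +-identityʳ (- x) ⟩
      - x       ∎

    0≤1 : 0# ≤ 1#
    0≤1 with ≤.total 0# 1#
    ... | inj₁ 0≤1 = 0≤1
    ... | inj₂ 1≤0 = begin
      0#             ≤⟨ *-nonNegative (neg-nonNegative 1≤0) (neg-nonNegative 1≤0) ⟩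
      - 1# * - 1#    ≈⟨ -‿distribˡ-* 1# (- 1#) ⟨
      - (1# * - 1#)  ≈⟨ -‿cong (*-identityˡ (- 1#)) ⟩
      - - 1#         ≈⟨ -‿involutive 1# ⟩
      1#             ∎

    1≰0 : ¬ (1# ≤ 0#)
    1≰0 1≤0 = 0#≉1# (≤.antisym 0≤1 1≤0)

    ·-nonNegative : ∀ n {x} → 0# ≤ x → 0# ≤ n · x
    ·-nonNegative zero    0≤x = ≤.refl
    ·-nonNegative (suc n) 0≤x = ≤.trans 0≤x (x≤x+y _ (·-nonNegative n 0≤x))

    1≤fromℕ : ∀ n .{{_ : ℕ.NonZero n}} → 1# ≤ fromℕ n
    1≤fromℕ (suc n) = x≤x+y 1# (·-nonNegative n 0≤1)

    fromℕ≉0 : ∀ n .{{_ : ℕ.NonZero n}} → ¬ (fromℕ n ≈ 0#)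
    fromℕ≉0 n n≈0 = 1≰0 (≤.trans (1≤fromℕ n) (≤.reflexive n≈0))

    ⁻¹-nonNegative : ∀ {x} → 0# ≤ x → ¬ (x ≈ 0#) → 0# ≤ x ⁻¹
    ⁻¹-nonNegative {x} 0≤x x≉0 with ≤.total 0# (x ⁻¹)
    ... | inj₁ 0≤x⁻¹ = 0≤x⁻¹
    ... | inj₂ x⁻¹≤0 = contradiction (begin
      1#                 ≈⟨ +-identityʳ 1# ⟨
      1# + 0#            ≤⟨ +-monoʳ-≤ 1# (*-nonNegative 0≤x (neg-nonNegative x⁻¹≤0)) ⟩
      1# + x * - x ⁻¹    ≈⟨ +-congˡ (-‿distribʳ-* x (x ⁻¹)) ⟨
      1# - x * x ⁻¹      ≈⟨ +-congˡ (-‿cong (⁻¹-inverseʳ x x≉0)) ⟩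
      1# - 1#            ≈⟨ -‿inverseʳ 1# ⟩
      0#                 ∎) 1≰0

    k!≉0 : ∀ k → ¬ (fromℕ (k !) ≈ 0#)
    k!≉0 k = fromℕ≉0 (k !) {{k !≢0}}

    0≤1/k! : ∀ k → 0# ≤ 1/ k !
    0≤1/k! k = ⁻¹-nonNegative (·-nonNegative (k !) 0≤1) (k!≉0 k)

    1/k!-step : ∀ k → 1/ k ! ≈ suc k · 1/ suc k !
    1/k!-step k = begin-equality
      p                          ≈⟨ *-identityʳ p ⟨
      p * 1#                     ≈⟨ *-congˡ (⁻¹-inverseʳ _ (k!≉0 (suc k))) ⟨
      p * (fromℕ (suc k !) * q)  ≈⟨ *-congˡ (*-congʳ (×1-homo-* (suc k) (k !))) ⟩
      p * (s * f * q)            ≈⟨ *-congˡ (*-congʳ (*-comm s f)) ⟩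
      p * (f * s * q)            ≈⟨ *-congˡ (*-assoc f s q) ⟩
      p * (f * (s * q))          ≈⟨ *-assoc p f (s * q) ⟨
      p * f * (s * q)            ≈⟨ *-congʳ (*-comm p f) ⟩
      f * p * (s * q)            ≈⟨ *-congʳ (⁻¹-inverseʳ f (k!≉0 k)) ⟩
      1# * (s * q)               ≈⟨ *-identityˡ (s * q) ⟩
      s * q                      ≈⟨ ×-assoc-* (suc k) 1# q ⟩
      suc k · (1# * q)           ≈⟨ +-cong (*-identityˡ q) (·-congʳ k (*-identityˡ q)) ⟩
      suc k · q                  ∎
      where
      p = 1/ k !
      q = 1/ suc k !
      f = fromℕ (k !)
      s = fromℕ (suc k)
      ·-congʳ : ∀ n {x y} → x ≈ y → n · x ≈ n · y
      ·-congʳ zero    x≈y = refl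
      ·-congʳ (suc n) x≈y = +-cong x≈y (·-congʳ n x≈y)

    bound : Carrier
    bound = expSum 2 + 1/ 1 !

    expSum-bound : ∀ n → expSum (2 ℕ.+ n) + 1/ suc n ! ≤ bound
    expSum-bound zero    = ≤.refl
    expSum-bound (suc n) = begin
      expSum (2 ℕ.+ n) + q + q          ≈⟨ +-assoc _ q q ⟩
      expSum (2 ℕ.+ n) + (q + q)        ≤⟨ +-monoʳ-≤ _ (+-monoʳ-≤ q (x≤x+y q (·-nonNegative n (0≤1/k! (2 ℕ.+ n))))) ⟩
      expSum (2 ℕ.+ n) + (2 ℕ.+ n) · q  ≈⟨ +-congˡ (1/k!-step (suc n)) ⟨
      expSum (2 ℕ.+ n) + 1/ suc n !     ≤⟨ expSum-bound n ⟩
      bound                             ∎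
      where q = 1/ 2 ℕ.+ n !

    expSum≤bound : ∀ n → expSum n ≤ bound
    expSum≤bound n = begin
      expSum n                       ≤⟨ x≤x+y _ (0≤1/k! n) ⟩
      expSum (suc n)                 ≤⟨ x≤x+y _ (0≤1/k! (suc n)) ⟩
      expSum (2 ℕ.+ n)               ≤⟨ x≤x+y _ (0≤1/k! (suc n)) ⟩
      expSum (2 ℕ.+ n) + 1/ suc n !  ≤⟨ expSum-bound n ⟩
      bound                          ∎

  e-supremum : ∃ (IsSupremum λ x → ∃[ n ] x ≈ expSum n)
  e-supremum = complete _ (0# , 0 , refl)
    (bound , λ { x (n , x≈) → ≤.trans (≤.reflexive x≈) (expSum≤bound n) })

  e : Carrier
  e = proj₁ e-supremum

module _ {A : Set} where

  insertions : A → List A → List (List A)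
  insertions x []       = (x ∷ []) ∷ []
  insertions x (y ∷ ys) = (x ∷ y ∷ ys) ∷ map (y ∷_) (insertions x ys)

  -- The n! rearrangements (by position) of a list of length n.
  permutations : List A → List (List A)
  permutations []       = [] ∷ []
  permutations (x ∷ xs) = concatMap (insertions x) (permutations xs)

module OnBAP (ℝ : CompleteOrderedField) where
  open CompleteOrderedField ℝ

  record Buyers : Set where
    field
      size     : ℕ
      budget   : Fin size → Carrier
      budget>0 : ∀ i → 0# < budget i

  module _ (L : Buyers) where
    open Buyers L

    Buyer : Set
    Buyer = Fin size

    -- bid i is meaningful only for neighbours i.
    record Item : Set where
      field
        neighbours : Subset size
        bid        : Buyer → Carrier
        bid≥0      : ∀ {i} → i ∈ neighbours → 0# ≤ bid i

    open Item public

    onEdge : Item → Buyer → Carrier → Carrier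
    onEdge j i v = if lookup (neighbours j) i then v else 0#

    ∑N : Item → (Buyer → Carrier) → Carrier
    ∑N j f = sum λ i → onEdge j i (f i)

    -- An instance with n items.
    Instance : ℕ → Set
    Instance n = Fin n → Item

    module _ {n : ℕ} (item : Instance n) where

      record Feasible (x : Buyer → Fin n → Carrier) : Set where
        field
          x≥0           : ∀ i j → i ∈ neighbours (item j) → 0# ≤ x i j
          within-budget : ∀ i → sum (λ j → onEdge (item j) i (bid (item j) i * x i j)) ≤ budget i
          within-item   : ∀ j → ∑N (item j) (λ i → x i j) ≤ 1#

      value : (Buyer → Fin n → Carrier) → Carrier
      value x = sum λ j → ∑N (item j) λ i → bid (item j) i * x i j

      IsOPT : Pred Carrier 0ℓ
      IsOPT = IsMaximum λ v → ∃[ x ] Feasible x × v ≈ value x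

      BidsWithinBudgets : Set
      BidsWithinBudgets = ∀ i j → i ∈ neighbours (item j) → bid (item j) i ≤ budget i

    -- Input sequences are listed with the latest arrival first,
    -- so j ∷ seq is the sequence seq followed by j.
    InputSequence : Set
    InputSequence = List Item

    -- rule seq j i is the fraction x i j given to buyer i when j arrives after
    -- seq; it is used only for neighbours i of j.
    Rule : Set
    Rule = InputSequence → Item → Buyer → Carrier

    waterLevel : Rule → InputSequence → Buyer → Carrier
    waterLevel rule []        i = 0#
    waterLevel rule (j ∷ seq) i =
      waterLevel rule seq i + onEdge j i (bid j i * rule seq j i)

    record OnlineAlgorithm : Set where
      field
        allocate      : Rule
        allocate≥0    : ∀ seq j {i} → i ∈ neighbours j → 0# ≤ allocate seq j i
        within-budget : ∀ seq i → waterLevel allocate seq i ≤ budget i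
        within-item   : ∀ seq j → ∑N j (allocate seq j) ≤ 1#

      level : InputSequence → Buyer → Carrier
      level = waterLevel allocate

    open OnlineAlgorithm

    -- A continuous allocation of item j, from water-levels y, ending in the
    -- allocation x. The clock is the fraction of j allocated so far:
    -- path t i is what buyer i has received of j once t of j is allocated.
    record GreedyProcess (y : Buyer → Carrier) (j : Item) (x : Buyer → Carrier) : Set where
      N : Pred Buyer 0ℓ
      N i = i ∈ neighbours j

      total : Carrier
      total = ∑N j x

      field
        path       : Carrier → Buyer → Carrier
        path-start : ∀ {i} → N i → path 0# i ≈ 0#
        path-end   : ∀ {i} → N i → path total i ≈ x i
        path-mono  : ∀ {i s t} → N i → 0# ≤ s → s ≤ t → t ≤ total → path s i ≤ path t i
        path-clock : ∀ {t} → 0# ≤ t → t ≤ total → ∑N j (path t) ≈ t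

      Exhausted : Carrier → Buyer → Set
      Exhausted t i = y i + bid j i * path t i ≈ budget i

      field
        -- Exhaustion persists as the clock advances, so if i receives some of
        -- j between s and t, then i is not exhausted at s, and any neighbour
        -- not exhausted at t was an alternative to i throughout.
        selects-maximum-bid :
          ∀ {i s t} → N i → 0# ≤ s → s < t → t ≤ total → path s i < path t i →
          ¬ Exhausted s i × (∀ {k} → N k → ¬ Exhausted t k → bid j k ≤ bid j i)

        no-waste : total < 1# → ∀ {i} → N i → Exhausted total i

    Greedy : OnlineAlgorithm → Set
    Greedy A = ∀ seq j → GreedyProcess (level A seq) j (allocate A seq j)

    _⪯_ : Rel (Buyer → Carrier) 0ℓ
    y ⪯ y′ = ∀ i → y i ≤ y′ i

    AllocationMonotone : OnlineAlgorithm → Set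
    AllocationMonotone A = ∀ seq₁ seq₂ j →
      level A seq₁ ⪯ level A seq₂ → level A (j ∷ seq₁) ⪯ level A (j ∷ seq₂)

    achieved : OnlineAlgorithm → InputSequence → Carrier
    achieved A []        = 0#
    achieved A (j ∷ seq) = achieved A seq + ∑N j λ i → bid j i * allocate A seq j i

    expectedValue : OnlineAlgorithm → ∀ {n} → Instance n → Carrier
    expectedValue A {n} item =
      mean (map (λ order → achieved A (map item order)) (permutations (allFin n)))

{-# OPTIONS --safe #-}
module Submission where

-- Let v be the value of a feasible allocation x, and N the number of items.
-- Greediness and b ≤ B give b_ij ≤ gain(j) + b_ij * y_i / B_i whenever j arrives
-- at water-levels y: either i ends unexhausted and all of j went to bids ≥ b_ij,
-- or i itself received B_i - y_i. Weighting by x charges the share of j in v to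
-- its gain and to the levels just before j. By monotonicity those levels, with j
-- removed from the pool of items, are on average at most the levels after one
-- more arrival from the whole pool. So the mean value Y_t after t arrivals
-- satisfies N (Y_{t+1} - Y_t) ≥ v - Y_{t+1}, and v - Y_N ≤ v (1 + 1/N)^(-N).
--
-- This bound is weaker than v / e. But by antisymmetry a monotone algorithm
-- depends on the past only through the water-levels, so isolated items can be
-- added without affecting the value, and N may be taken arbitrarily large.

open import Defs
open import Data.Bool.Base using (if_then_else_)
open import Data.Fin.Base using (Fin; zero; suc)
open import Data.Fin.Subset using (_∈_; ⊥; inside; outside)
open import Data.List.Base using (List; []; _∷_; _++_; map; foldr; concatMap; length; allFin; tabulate)
open import Data.List.Properties using (map-∘; map-cong; map-tabulate; length-map; length-tabulate)
open import Data.List.Relation.Binary.Permutation.Propositional as ↭ using (_↭_)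
open import Data.List.Relation.Binary.Permutation.Propositional.Properties using (↭-length)
open import Data.Maybe.Base using (Maybe; just; nothing; maybe)
open import Data.Nat.Base using (ℕ; zero; suc; _!)
import Data.Nat.Base as ℕ
import Data.Nat.Properties as ℕ
open import Data.Product.Base using (∃; ∃-syntax; _×_; _,_; proj₁; proj₂)
open import Data.Sum.Base using (inj₁; inj₂)
open import Data.Vec.Base using (lookup)
open import Data.Vec.Properties using (lookup⇒[]=; []=⇒lookup; lookup-replicate)
open import Relation.Nullary using (¬_; yes; no)
open import Relation.Nullary.Negation using (contradiction)
open import Relation.Binary.PropositionalEquality as ≡ using (_≡_)
import Relation.Binary.Reasoning.PartialOrder
import Algebra.Solver.Ring.NaturalCoefficients.Default
import Algebra.Properties.Ring
import Algebra.Properties.Semiring.Exp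
import Algebra.Properties.Semiring.Mult
import Algebra.Properties.Semiring.Sum

-- Order arithmetic in a complete ordered field and the Archimedean property.

module OrderedField (ℝ : CompleteOrderedField) where
  open CompleteOrderedField ℝ hiding (zero)
  open Algebra.Properties.Ring ring
    using (-‿distribˡ-*; -‿involutive)
  open Algebra.Properties.Semiring.Exp semiring using (_^_)
  open Algebra.Solver.Ring.NaturalCoefficients.Default commutativeSemiring
    using (solve; _:+_; _:*_; _:=_; con)
  open Relation.Binary.Reasoning.PartialOrder poset

  +-mono-≤ : ∀ {w x y z} → w ≤ x → y ≤ z → w + y ≤ x + z
  +-mono-≤ {w} {x} {y} {z} w≤x y≤z = begin
    w + y  ≤⟨ +-monoʳ-≤ w y≤z ⟩
    w + z  ≈⟨ +-comm w z ⟩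
    z + w  ≤⟨ +-monoʳ-≤ z w≤x ⟩
    z + x  ≈⟨ +-comm z x ⟩
    x + z  ∎

  +-monoˡ-≤ : ∀ z {x y} → x ≤ y → x + z ≤ y + z
  +-monoˡ-≤ z x≤y = +-mono-≤ x≤y ≤.refl

  x≤x+y : ∀ x {y} → 0# ≤ y → x ≤ x + y
  x≤x+y x {y} 0≤y = begin
    x       ≈⟨ +-identityʳ x ⟨
    x + 0#  ≤⟨ +-monoʳ-≤ x 0≤y ⟩
    x + y   ∎

  x≤y+x : ∀ x {y} → 0# ≤ y → x ≤ y + x
  x≤y+x x {y} 0≤y = ≤.trans (x≤x+y x 0≤y) (≤.reflexive (+-comm x y))

  +-nonNegative : ∀ {x y} → 0# ≤ x → 0# ≤ y → 0# ≤ x + y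
  +-nonNegative 0≤x 0≤y = ≤.trans 0≤x (x≤x+y _ 0≤y)

  +-cancelʳ-≤ : ∀ z {x y} → x + z ≤ y + z → x ≤ y
  +-cancelʳ-≤ z {x} {y} x+z≤y+z = begin
    x            ≈⟨ undo x ⟨
    x + z + - z  ≤⟨ +-monoˡ-≤ (- z) x+z≤y+z ⟩
    y + z + - z  ≈⟨ undo y ⟩
    y            ∎
    where
    undo : ∀ w → w + z + - z ≈ w
    undo w = trans (+-assoc w z (- z))
      (trans (+-congˡ (-‿inverseʳ z)) (+-identityʳ w))

  x-y+y≈x : ∀ x y → x - y + y ≈ x
  x-y+y≈x x y = trans (+-assoc x (- y) y)
    (trans (+-congˡ (-‿inverseˡ y)) (+-identityʳ x))

  x≤y⇒0≤y-x : ∀ {x y} → x ≤ y → 0# ≤ y - x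
  x≤y⇒0≤y-x {x} {y} x≤y = +-cancelʳ-≤ x (begin
    0# + x     ≈⟨ +-identityˡ x ⟩
    x          ≤⟨ x≤y ⟩
    y          ≈⟨ x-y+y≈x y x ⟨
    y - x + x  ∎)

  *-monoʳ-≤ : ∀ {z x y} → 0# ≤ z → x ≤ y → z * x ≤ z * y
  *-monoʳ-≤ {z} {x} {y} 0≤z x≤y = begin
    z * x                ≤⟨ x≤y+x _ (*-nonNegative 0≤z (x≤y⇒0≤y-x x≤y)) ⟩
    z * (y - x) + z * x  ≈⟨ distribˡ z (y - x) x ⟨
    z * (y - x + x)      ≈⟨ *-congˡ (x-y+y≈x y x) ⟩
    z * y                ∎

  *-monoˡ-≤ : ∀ {z x y} → 0# ≤ z → x ≤ y → x * z ≤ y * z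
  *-monoˡ-≤ {z} {x} {y} 0≤z x≤y = begin
    x * z  ≈⟨ *-comm x z ⟩
    z * x  ≤⟨ *-monoʳ-≤ 0≤z x≤y ⟩
    z * y  ≈⟨ *-comm z y ⟩
    y * z  ∎

  x≤0⇒0≤-x : ∀ {x} → x ≤ 0# → 0# ≤ - x
  x≤0⇒0≤-x {x} x≤0 = ≤.trans (x≤y⇒0≤y-x x≤0) (≤.reflexive (+-identityˡ (- x)))

  0≤1 : 0# ≤ 1#
  0≤1 with ≤.total 0# 1#
  ... | inj₁ 0≤1 = 0≤1
  ... | inj₂ 1≤0 = begin
    0#             ≤⟨ *-nonNegative (x≤0⇒0≤-x 1≤0) (x≤0⇒0≤-x 1≤0) ⟩
    - 1# * - 1#    ≈⟨ -‿distribˡ-* 1# (- 1#) ⟨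
    - (1# * - 1#)  ≈⟨ -‿cong (*-identityˡ (- 1#)) ⟩
    - - 1#         ≈⟨ -‿involutive 1# ⟩
    1#             ∎

  1≰0 : ¬ (1# ≤ 0#)
  1≰0 1≤0 = 0#≉1# (≤.antisym 0≤1 1≤0)

  <⇒≉0 : ∀ {x} → 0# < x → ¬ (x ≈ 0#)
  <⇒≉0 (_ , 0≉x) x≈0 = 0≉x (sym x≈0)

  1≤x⇒0<x : ∀ {x} → 1# ≤ x → 0# < x
  1≤x⇒0<x 1≤x = ≤.trans 0≤1 1≤x , λ 0≈x → 1≰0 (≤.trans 1≤x (≤.reflexive (sym 0≈x)))

  ⁻¹-inverseˡ : ∀ x → ¬ (x ≈ 0#) → x ⁻¹ * x ≈ 1#
  ⁻¹-inverseˡ x x≉0 = trans (*-comm (x ⁻¹) x) (⁻¹-inverseʳ x x≉0)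

  ⁻¹-nonNegative : ∀ {x} → 0# < x → 0# ≤ x ⁻¹
  ⁻¹-nonNegative {x} 0<x with ≤.total 0# (x ⁻¹)
  ... | inj₁ 0≤x⁻¹ = 0≤x⁻¹
  ... | inj₂ x⁻¹≤0 = contradiction (begin
    1#        ≈⟨ ⁻¹-inverseʳ x (<⇒≉0 0<x) ⟨
    x * x ⁻¹  ≤⟨ *-monoʳ-≤ (proj₁ 0<x) x⁻¹≤0 ⟩
    x * 0#    ≈⟨ zeroʳ x ⟩
    0#        ∎) 1≰0

  *-cancelˡ-≤ : ∀ {z x y} → 0# < z → z * x ≤ z * y → x ≤ y
  *-cancelˡ-≤ {z} {x} {y} 0<z zx≤zy = begin
    x               ≈⟨ undo x ⟨
    z ⁻¹ * (z * x)  ≤⟨ *-monoʳ-≤ (⁻¹-nonNegative 0<z) zx≤zy ⟩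
    z ⁻¹ * (z * y)  ≈⟨ undo y ⟩
    y               ∎
    where
    undo : ∀ w → z ⁻¹ * (z * w) ≈ w
    undo w = trans (sym (*-assoc (z ⁻¹) z w))
      (trans (*-congʳ (⁻¹-inverseˡ z (<⇒≉0 0<z))) (*-identityˡ w))

  *-positive : ∀ {x y} → 0# < x → 0# < y → 0# < x * y
  *-positive {x} {y} 0<x 0<y =
    *-nonNegative (proj₁ 0<x) (proj₁ 0<y) ,
    λ 0≈xy → proj₂ 0<y (≤.antisym (proj₁ 0<y) (*-cancelˡ-≤ 0<x (begin
      x * y   ≈⟨ 0≈xy ⟨
      0#      ≈⟨ zeroʳ x ⟨
      x * 0#  ∎)))

  fromℕ-nonNegative : ∀ n → 0# ≤ fromℕ n
  fromℕ-nonNegative zero    = ≤.refl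
  fromℕ-nonNegative (suc n) = +-nonNegative 0≤1 (fromℕ-nonNegative n)

  fromℕ-positive : ∀ n .{{_ : ℕ.NonZero n}} → 0# < fromℕ n
  fromℕ-positive (suc n) = 1≤x⇒0<x (x≤x+y 1# (fromℕ-nonNegative n))

  fromℕ-homo-+ : ∀ m n → fromℕ (m ℕ.+ n) ≈ fromℕ m + fromℕ n
  fromℕ-homo-+ zero    n = sym (+-identityˡ _)
  fromℕ-homo-+ (suc m) n = trans (+-congˡ (fromℕ-homo-+ m n)) (sym (+-assoc 1# _ _))

  ^-nonNegative : ∀ {x} n → 0# ≤ x → 0# ≤ x ^ n
  ^-nonNegative zero    0≤x = 0≤1
  ^-nonNegative (suc n) 0≤x = *-nonNegative 0≤x (^-nonNegative n 0≤x)

  ^-positive : ∀ {x} n → 0# < x → 0# < x ^ n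
  ^-positive zero    0<x = 1≤x⇒0<x ≤.refl
  ^-positive (suc n) 0<x = *-positive 0<x (^-positive n 0<x)

  ^-monoˡ-≤ : ∀ {x y} n → 0# ≤ x → x ≤ y → x ^ n ≤ y ^ n
  ^-monoˡ-≤ zero    0≤x x≤y = ≤.refl
  ^-monoˡ-≤ {x} {y} (suc n) 0≤x x≤y = begin
    x * x ^ n  ≤⟨ *-monoʳ-≤ 0≤x (^-monoˡ-≤ n 0≤x x≤y) ⟩
    x * y ^ n  ≤⟨ *-monoˡ-≤ (^-nonNegative n (≤.trans 0≤x x≤y)) x≤y ⟩
    y * y ^ n  ∎

  1^n≈1 : ∀ n → 1# ^ n ≈ 1#
  1^n≈1 zero    = refl
  1^n≈1 (suc n) = trans (*-identityˡ _) (1^n≈1 n)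

  sum-mono : ∀ {n} {f g : Fin n → Carrier} → (∀ i → f i ≤ g i) → sum f ≤ sum g
  sum-mono {zero}  f≤g = ≤.refl
  sum-mono {suc n} f≤g = +-mono-≤ (f≤g zero) (sum-mono λ i → f≤g (suc i))

  sum-nonNegative : ∀ {n} {f : Fin n → Carrier} → (∀ i → 0# ≤ f i) → 0# ≤ sum f
  sum-nonNegative {zero}  0≤f = ≤.refl
  sum-nonNegative {suc n} 0≤f = +-nonNegative (0≤f zero) (sum-nonNegative λ i → 0≤f (suc i))

  term≤sum : ∀ {n} {f : Fin n → Carrier} → (∀ i → 0# ≤ f i) → ∀ i → f i ≤ sum f
  term≤sum 0≤f zero    = x≤x+y _ (sum-nonNegative λ i → 0≤f (suc i))
  term≤sum 0≤f (suc i) =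
    ≤.trans (term≤sum (λ i → 0≤f (suc i)) i) (x≤y+x _ (0≤f zero))

  -- The least upper bound s of the multiples of δ satisfies s ≤ s - δ.
  archimedean : ∀ {δ u} → (∀ m → fromℕ m * δ ≤ u) → δ ≤ 0#
  archimedean {δ} {u} bounded = +-cancelʳ-≤ s (begin
    δ + s        ≤⟨ +-monoʳ-≤ δ s≤s-δ ⟩
    δ + (s - δ)  ≈⟨ +-comm δ (s - δ) ⟩
    s - δ + δ    ≈⟨ x-y+y≈x s δ ⟩
    s            ≈⟨ +-identityˡ s ⟨
    0# + s       ∎)
    where
    supremum : ∃ (IsSupremum λ x → ∃[ m ] x ≈ fromℕ m * δ)
    supremum = complete _ (0# * δ , 0 , refl)
      (u , λ { x (m , x≈) → ≤.trans (≤.reflexive x≈) (bounded m) })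
    s = proj₁ supremum
    s≤s-δ : s ≤ s - δ
    s≤s-δ = proj₂ (proj₂ supremum) (s - δ) λ { x (m , x≈) → +-cancelʳ-≤ δ (begin
      x + δ              ≈⟨ +-congʳ x≈ ⟩
      fromℕ m * δ + δ    ≈⟨ solve 2 (λ m δ → m :* δ :+ δ := (con 1 :+ m) :* δ) refl (fromℕ m) δ ⟩
      fromℕ (suc m) * δ  ≤⟨ proj₁ (proj₂ supremum) _ (suc m , refl) ⟩
      s                  ≈⟨ x-y+y≈x s δ ⟨
      s - δ + δ          ∎) }

  -- All multiples of `a - b` stay below `c`, so `archimedean` applies to this difference. The lemma
  -- lets an error term that does not grow with `m` be dropped in the limit.
  archimedean-≤ : ∀ {a b c} → (∀ m → fromℕ m * a ≤ fromℕ m * b + c) → a ≤ b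
  archimedean-≤ {a} {b} {c} bounded = begin
    a            ≈⟨ x-y+y≈x a b ⟨
    a - b + b    ≤⟨ +-monoˡ-≤ b (archimedean λ m → +-cancelʳ-≤ (fromℕ m * b) (begin
      fromℕ m * (a - b) + fromℕ m * b  ≈⟨ distribˡ _ _ _ ⟨
      fromℕ m * (a - b + b)            ≈⟨ *-congˡ (x-y+y≈x a b) ⟩
      fromℕ m * a                      ≤⟨ bounded m ⟩
      fromℕ m * b + c                  ≈⟨ +-comm _ _ ⟩
      c + fromℕ m * b                  ∎)) ⟩
    0# + b       ≈⟨ +-identityˡ b ⟩
    b            ∎

-- Comparison of powers of 1 + 1/n with the exponential series.

module ExponentialBound (ℝ : CompleteOrderedField) where
  open CompleteOrderedField ℝ
  open Euler ℝ
  open OrderedField ℝ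
  open Algebra.Properties.Semiring.Mult semiring using (×1-homo-*)
  open Algebra.Properties.Semiring.Exp semiring using (_^_; ^-congˡ)
  open Algebra.Solver.Ring.NaturalCoefficients.Default commutativeSemiring
    using (solve; _:+_; _:*_; _:=_; con)
  open Relation.Binary.Reasoning.PartialOrder poset

  fromℕ[k!]>0 : ∀ k → 0# < fromℕ (k !)
  fromℕ[k!]>0 k = fromℕ-positive (k !) {{ℕ._!≢0 k}}

  0≤1/k! : ∀ k → 0# ≤ 1/ k !
  0≤1/k! k = ⁻¹-nonNegative (fromℕ[k!]>0 k)

  1/[1+k]!-step : ∀ k → fromℕ (suc k) * 1/ suc k ! ≈ 1/ k !
  1/[1+k]!-step k = begin-equality
    s * q              ≈⟨ *-identityˡ _ ⟨
    1# * (s * q)       ≈⟨ *-congʳ (⁻¹-inverseʳ f (<⇒≉0 (fromℕ[k!]>0 k))) ⟨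
    f * p * (s * q)    ≈⟨ solve 4 (λ f p s q → f :* p :* (s :* q) := p :* (s :* f :* q)) refl f p s q ⟩
    p * (s * f * q)    ≈⟨ *-congˡ (*-congʳ (×1-homo-* (suc k) (k !))) ⟨
    p * (fromℕ (suc k !) * q)  ≈⟨ *-congˡ (⁻¹-inverseʳ _ (<⇒≉0 (fromℕ[k!]>0 (suc k)))) ⟩
    p * 1#             ≈⟨ *-identityʳ p ⟩
    p                  ∎
    where
    p = 1/ k !
    q = 1/ suc k !
    f = fromℕ (k !)
    s = fromℕ (suc k)

  -- The exponential series at `z`, truncated to degrees below `k`. A variable point is needed
  -- because the comparison with powers walks from 0 to 1 in small steps.
  expSumAt : ℕ → Carrier → Carrier
  expSumAt zero    z = 0#
  expSumAt (suc k) z = expSumAt k z + z ^ k * 1/ k !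

  expSumAt-cong : ∀ k {y z} → y ≈ z → expSumAt k y ≈ expSumAt k z
  expSumAt-cong zero    y≈z = refl
  expSumAt-cong (suc k) y≈z = +-cong (expSumAt-cong k y≈z) (*-congʳ (^-congˡ k y≈z))

  expSumAt-1 : ∀ k → expSumAt k 1# ≈ expSum k
  expSumAt-1 zero    = refl
  expSumAt-1 (suc k) =
    +-cong (expSumAt-1 k) (trans (*-congʳ (1^n≈1 k)) (*-identityˡ _))

  -- Equality fails only for the empty sum `k = 0`; otherwise the degree-zero term contributes 1 and
  -- every other term vanishes.
  expSumAt-0 : ∀ k → expSumAt k 0# ≤ 1#
  expSumAt-0 zero          = 0≤1
  expSumAt-0 (suc zero)    = begin
    0# + 1# * 1/ 0 !  ≈⟨ trans (+-identityˡ _) (*-congʳ (sym (+-identityʳ 1#))) ⟩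
    fromℕ 1 * 1/ 0 !  ≈⟨ ⁻¹-inverseʳ _ (<⇒≉0 (fromℕ[k!]>0 0)) ⟩
    1#                ∎
  expSumAt-0 (suc (suc k)) = begin
    expSumAt (suc k) 0# + 0# * 0# ^ k * 1/ suc k !
      ≈⟨ +-congˡ (trans (*-congʳ (zeroˡ _)) (zeroˡ _)) ⟩
    expSumAt (suc k) 0# + 0#  ≈⟨ +-identityʳ _ ⟩
    expSumAt (suc k) 0#       ≤⟨ expSumAt-0 (suc k) ⟩
    1#                        ∎

  module _ {z x : Carrier} (0≤z : 0# ≤ z) (0≤x : 0# ≤ x) where
    private
      w = z + x
      0≤w : 0# ≤ w
      0≤w = +-nonNegative 0≤z 0≤x
      z≤w : z ≤ w
      z≤w = x≤x+y z 0≤x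

    -- A mean value estimate: on the way from `z` to `w = z + x` the slope of the power is at most
    -- its value at the right end `w`.
    ^-step : ∀ k → w ^ suc k ≤ z ^ suc k + fromℕ (suc k) * (x * w ^ k)
    ^-step zero = ≤.reflexive (begin-equality
      (z + x) * 1#                      ≈⟨ solve 2 (λ z x → (z :+ x) :* con 1 := z :* con 1 :+ con 1 :* (x :* con 1)) refl z x ⟩
      z * 1# + 1# * (x * 1#)            ≈⟨ +-congˡ (*-congʳ (+-identityʳ 1#)) ⟨
      z * 1# + fromℕ 1 * (x * 1#)       ∎)
    ^-step (suc k) = begin
      w * w ^ suc k
        ≤⟨ *-monoʳ-≤ 0≤w (^-step k) ⟩
      w * (z ^ suc k + s * (x * w ^ k))
        ≈⟨ solve 5 (λ z x u s v → (z :+ x) :* (u :+ s :* (x :* v)) :=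
             z :* u :+ (x :* u :+ s :* (x :* ((z :+ x) :* v)))) refl z x (z ^ suc k) s (w ^ k) ⟩
      z * z ^ suc k + (x * z ^ suc k + s * (x * w ^ suc k))
        ≤⟨ +-monoʳ-≤ _ (+-monoˡ-≤ _ (*-monoʳ-≤ 0≤x (^-monoˡ-≤ (suc k) 0≤z z≤w))) ⟩
      z * z ^ suc k + (x * w ^ suc k + s * (x * w ^ suc k))
        ≈⟨ +-congˡ (solve 2 (λ a s → a :+ s :* a := (con 1 :+ s) :* a) refl (x * w ^ suc k) s) ⟩
      z ^ suc (suc k) + fromℕ (suc (suc k)) * (x * w ^ suc k) ∎
      where s = fromℕ (suc k)

    -- The same estimate summed over all degrees. The derivative of the truncated series is the
    -- series with one term fewer, since `(k + 1) / (k + 1)! = 1 / k!`.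
    expSumAt-step′ : ∀ k → expSumAt (suc k) w ≤ expSumAt (suc k) z + x * expSumAt k w
    expSumAt-step′ zero = begin
      0# + 1# * 1/ 0 !            ≈⟨ +-identityʳ _ ⟨
      0# + 1# * 1/ 0 ! + 0#       ≈⟨ +-congˡ (zeroʳ x) ⟨
      0# + 1# * 1/ 0 ! + x * 0#   ∎
    expSumAt-step′ (suc k) = begin
      expSumAt (suc k) w + w ^ suc k * q
        ≤⟨ +-mono-≤ (expSumAt-step′ k) (*-monoˡ-≤ (0≤1/k! (suc k)) (^-step k)) ⟩
      a + x * b + (z ^ suc k + s * (x * w ^ k)) * q
        ≈⟨ solve 7 (λ a x b u s v q → a :+ x :* b :+ (u :+ s :* (x :* v)) :* q :=
             a :+ u :* q :+ x :* (b :+ v :* (s :* q))) refl a x b (z ^ suc k) s (w ^ k) q ⟩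
      a + z ^ suc k * q + x * (b + w ^ k * (s * q))
        ≈⟨ +-congˡ (*-congˡ (+-congˡ (*-congˡ (1/[1+k]!-step k)))) ⟩
      expSumAt (suc (suc k)) z + x * expSumAt (suc k) w ∎
      where
      s = fromℕ (suc k)
      q = 1/ suc k !
      a = expSumAt (suc k) z
      b = expSumAt k w

    -- e^(z + x) * (1 - x) ≤ e^z, for the truncated series.
    expSumAt-step : ∀ k → expSumAt k w ≤ expSumAt k z + x * expSumAt k w
    expSumAt-step zero    = ≤.reflexive (sym (trans (+-identityˡ _) (zeroʳ x)))
    expSumAt-step (suc k) = ≤.trans (expSumAt-step′ k) (+-monoʳ-≤ _ (*-monoʳ-≤ 0≤x
      (x≤x+y _ (*-nonNegative (^-nonNegative k 0≤w) (0≤1/k! k)))))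

  module _ (k n : ℕ) where
    private
      M = fromℕ (suc n)
      N = fromℕ n
      M>0 : 0# < M
      M>0 = fromℕ-positive (suc n)
      x = M ⁻¹
      0≤x : 0# ≤ x
      0≤x = ⁻¹-nonNegative M>0
      Mx≈1 : M * x ≈ 1#
      Mx≈1 = ⁻¹-inverseʳ M (<⇒≉0 M>0)
      E : Carrier → Carrier
      E = expSumAt k

      -- For `x = 1/M` the factor `1 - x` of `expSumAt-step` is `N/M`; multiplying by `M` clears the
      -- subtraction and the division.
      scaled-step : ∀ {z} → 0# ≤ z → N * E (z + x) ≤ M * E z
      scaled-step {z} 0≤z = +-cancelʳ-≤ (E w) (begin
        N * E w + E w            ≈⟨ solve 2 (λ n e → n :* e :+ e := (con 1 :+ n) :* e) refl N (E w) ⟩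
        M * E w                  ≤⟨ *-monoʳ-≤ (proj₁ M>0) (expSumAt-step 0≤z 0≤x k) ⟩
        M * (E z + x * E w)      ≈⟨ solve 4 (λ m a x b → m :* (a :+ x :* b) := m :* a :+ m :* x :* b) refl M (E z) x (E w) ⟩
        M * E z + M * x * E w    ≈⟨ +-congˡ (trans (*-congʳ Mx≈1) (*-identityˡ _)) ⟩
        M * E z + E w            ∎)
        where w = z + x

      -- Starting from the value at 0, each of the `m` steps of length `1/M` raises the truncated
      -- series by a factor of at most `M/N`.
      scaled : ∀ m → N ^ m * E (fromℕ m * x) ≤ M ^ m
      scaled zero = begin
        1# * E (0# * x)  ≈⟨ trans (*-identityˡ _) (expSumAt-cong k (zeroˡ x)) ⟩
        E 0#             ≤⟨ expSumAt-0 k ⟩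
        1#               ∎
      scaled (suc m) = begin
        N * N ^ m * E (fromℕ (suc m) * x)
          ≈⟨ *-congˡ (expSumAt-cong k (solve 2 (λ m x → (con 1 :+ m) :* x := m :* x :+ x) refl (fromℕ m) x)) ⟩
        N * N ^ m * E (z + x)
          ≈⟨ solve 3 (λ a b c → a :* b :* c := b :* (a :* c)) refl N (N ^ m) (E (z + x)) ⟩
        N ^ m * (N * E (z + x))
          ≤⟨ *-monoʳ-≤ (^-nonNegative m (fromℕ-nonNegative n)) (scaled-step (*-nonNegative (fromℕ-nonNegative m) 0≤x)) ⟩
        N ^ m * (M * E z)
          ≈⟨ solve 3 (λ a b c → a :* (b :* c) := b :* (a :* c)) refl (N ^ m) M (E z) ⟩
        M * (N ^ m * E z)
          ≤⟨ *-monoʳ-≤ (proj₁ M>0) (scaled m) ⟩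
        M * M ^ m  ∎
        where z = fromℕ m * x

    -- `M = n + 1` steps of length `1/M` end exactly at the point 1. This is
    -- `expSum k ≤ (1 + 1/n)^(n+1)` without division.
    n^[1+n]*expSum≤[1+n]^[1+n] : N ^ suc n * expSum k ≤ M ^ suc n
    n^[1+n]*expSum≤[1+n]^[1+n] = begin
      N ^ suc n * expSum k   ≈⟨ *-congˡ (trans (expSumAt-cong k Mx≈1) (expSumAt-1 k)) ⟨
      N ^ suc n * E (M * x)  ≤⟨ scaled (suc n) ⟩
      M ^ suc n              ∎

  -- Passage from the partial sums to e.

  0≤expSum : ∀ k → 0# ≤ expSum k
  0≤expSum zero    = ≤.refl
  0≤expSum (suc k) = +-nonNegative (0≤expSum k) (0≤1/k! k)

  1≤e : 1# ≤ e
  1≤e = begin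
    1#                ≈⟨ ⁻¹-inverseʳ _ (<⇒≉0 (fromℕ[k!]>0 0)) ⟨
    fromℕ 1 * 1/ 0 !  ≈⟨ trans (*-congʳ (+-identityʳ 1#)) (*-identityˡ _) ⟩
    1/ 0 !            ≈⟨ +-identityˡ _ ⟨
    expSum 1          ≤⟨ proj₁ (proj₂ e-supremum) _ (1 , refl) ⟩
    e                 ∎

  0<e : 0# < e
  0<e = 1≤x⇒0<x 1≤e

  -- After division by `d`, the hypothesis says that `d ⁻¹ * u` bounds every partial sum, hence also
  -- their supremum.
  e-least : ∀ {d u} → 0# < d → (∀ k → d * expSum k ≤ u) → d * e ≤ u
  e-least {d} {u} 0<d bounded = begin
    d * e           ≤⟨ *-monoʳ-≤ (proj₁ 0<d) (proj₂ (proj₂ e-supremum) (d ⁻¹ * u)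
      λ { x (k , x≈) → *-cancelˡ-≤ 0<d (begin
        d * x             ≈⟨ *-congˡ x≈ ⟩
        d * expSum k      ≤⟨ bounded k ⟩
        u                 ≈⟨ undo ⟨
        d * (d ⁻¹ * u)    ∎) }) ⟩
    d * (d ⁻¹ * u)  ≈⟨ undo ⟩
    u               ∎
    where
    undo : d * (d ⁻¹ * u) ≈ u
    undo = trans (sym (*-assoc d _ u))
      (trans (*-congʳ (⁻¹-inverseʳ d (<⇒≉0 0<d))) (*-identityˡ u))

  -- (1 + 1/N)^N * (v - a) ≤ v for all large N, multiplied out.
  [e-1]/e-bound : ∀ {v a} n → 0# ≤ v →
    (∀ m → let N = suc m ℕ.+ n in
      fromℕ (suc N) ^ N * v ≤ fromℕ (suc N) ^ N * a + fromℕ N ^ N * v) →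
    ((e - 1#) * e ⁻¹) * v ≤ a
  [e-1]/e-bound {v} {a} n 0≤v bounds = +-cancelʳ-≤ (i * v) (begin
    (e - 1#) * i * v + i * v   ≈⟨ solve 3 (λ f i v → f :* i :* v :+ i :* v := (f :+ con 1) :* i :* v) refl (e - 1#) i v ⟩
    (e - 1# + 1#) * i * v      ≈⟨ *-congʳ (*-congʳ (x-y+y≈x e 1#)) ⟩
    e * i * v                  ≈⟨ trans (*-congʳ (⁻¹-inverseʳ e (<⇒≉0 0<e))) (*-identityˡ v) ⟩
    v                          ≈⟨ x-y+y≈x v a ⟨
    v - a + a                  ≈⟨ +-comm _ _ ⟩
    a + (v - a)                ≤⟨ +-monoʳ-≤ a deficit ⟩
    a + i * v                  ∎)
    where
    i = e ⁻¹
    d = v - a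
    module _ (0<d : 0# < d) (k m : ℕ) where
      N = suc m ℕ.+ n
      M^N = fromℕ (suc N) ^ N
      N^N = fromℕ N ^ N

      M^N*d≤N^N*v : M^N * d ≤ N^N * v
      M^N*d≤N^N*v = +-cancelʳ-≤ (M^N * a) (begin
        M^N * d + M^N * a  ≈⟨ distribˡ _ _ _ ⟨
        M^N * (d + a)      ≈⟨ *-congˡ (x-y+y≈x v a) ⟩
        M^N * v            ≤⟨ bounds m ⟩
        M^N * a + N^N * v  ≈⟨ +-comm _ _ ⟩
        N^N * v + M^N * a  ∎)

      -- The power comparison has exponent `N + 1` while the hypothesis `bounds` has exponent `N`.
      -- After cancelling `N^N` the mismatch costs the factor `(N + 1)/N`, which tends to 1.
      large : fromℕ N * (d * expSum k) ≤ fromℕ (suc N) * v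
      large = *-cancelˡ-≤ (^-positive N (fromℕ-positive N)) (begin
        N^N * (fromℕ N * (d * expSum k))   ≈⟨ solve 4 (λ a b c d → a :* (b :* (c :* d)) := (b :* a :* d) :* c) refl N^N (fromℕ N) d (expSum k) ⟩
        fromℕ N ^ suc N * expSum k * d     ≤⟨ *-monoˡ-≤ (proj₁ 0<d) (n^[1+n]*expSum≤[1+n]^[1+n] k N) ⟩
        fromℕ (suc N) * M^N * d            ≈⟨ *-assoc _ _ _ ⟩
        fromℕ (suc N) * (M^N * d)          ≤⟨ *-monoʳ-≤ (fromℕ-nonNegative (suc N)) M^N*d≤N^N*v ⟩
        fromℕ (suc N) * (N^N * v)          ≈⟨ solve 3 (λ a b c → a :* (b :* c) := b :* (a :* c)) refl (fromℕ (suc N)) N^N v ⟩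
        N^N * (fromℕ (suc N) * v)          ∎)

    -- With `N = m + 1 + n`, the inequality `large` reads `N X ≤ (N + 1) v`, so `m X` exceeds `m v`
    -- by at most the constant `(n + 2) v`, which `archimedean-≤` removes.
    expSum-bound : 0# < d → ∀ k → d * expSum k ≤ v
    expSum-bound 0<d k = archimedean-≤ λ m → begin
      fromℕ m * X
        ≤⟨ x≤x+y _ (*-nonNegative (fromℕ-nonNegative (suc n)) (*-nonNegative (proj₁ 0<d) (0≤expSum k))) ⟩
      fromℕ m * X + fromℕ (suc n) * X
        ≈⟨ regroup m X n ⟩
      fromℕ (suc m ℕ.+ n) * X
        ≤⟨ large 0<d k m ⟩
      fromℕ (suc (suc m ℕ.+ n)) * v
        ≈⟨ *-congʳ (reflexive (≡.cong (λ l → fromℕ (suc l)) (ℕ.+-suc m n))) ⟨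
      fromℕ (suc m ℕ.+ suc n) * v
        ≈⟨ regroup m v (suc n) ⟨
      fromℕ m * v + fromℕ (suc (suc n)) * v ∎
      where
      X = d * expSum k
      regroup : ∀ m x n → fromℕ m * x + fromℕ (suc n) * x ≈ fromℕ (suc m ℕ.+ n) * x
      regroup m x n = trans
        (solve 3 (λ m x n → m :* x :+ (con 1 :+ n) :* x := (con 1 :+ (m :+ n)) :* x) refl (fromℕ m) x (fromℕ n))
        (*-congʳ (+-congˡ (sym (fromℕ-homo-+ m n))))

    -- `e-least` needs a positive factor, so the case of a deficit at most 0 is split off; there
    -- `0 ≤ v / e` suffices.
    deficit : d ≤ i * v
    deficit with ≤.total d 0#
    ... | inj₁ d≤0 = ≤.trans d≤0 (*-nonNegative (⁻¹-nonNegative 0<e) 0≤v)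
    ... | inj₂ 0≤d with 0# ≤.≟ d
    ...   | yes 0≈d = ≤.trans (≤.reflexive (sym 0≈d)) (*-nonNegative (⁻¹-nonNegative 0<e) 0≤v)
    ...   | no  0≉d = *-cancelˡ-≤ 0<e (begin
      e * d        ≈⟨ *-comm e d ⟩
      d * e        ≤⟨ e-least (0≤d , 0≉d) (expSum-bound (0≤d , 0≉d)) ⟩
      v            ≈⟨ trans (*-congʳ (⁻¹-inverseʳ e (<⇒≉0 0<e))) (*-identityˡ v) ⟨
      e * i * v    ≈⟨ *-assoc e i v ⟩
      e * (i * v)  ∎)

-- Sums over picks and over ordered selections from a pool.

module Selections (ℝ : CompleteOrderedField) {A : Set} where
  open CompleteOrderedField ℝ hiding (zero)
  open OrderedField ℝ
  open Algebra.Solver.Ring.NaturalCoefficients.Default commutativeSemiring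
    using (solve; _:+_; _:*_; _:=_; con)
  open Relation.Binary.Reasoning.PartialOrder poset

  -- The sum of h x r over the ways to split xs into an element x and the rest r.
  ∑pick : (A → List A → Carrier) → List A → Carrier
  ∑pick h []       = 0#
  ∑pick h (x ∷ xs) = h x xs + ∑pick (λ y r → h y (x ∷ r)) xs

  ∑pick-mono : ∀ {h h′} xs → (∀ x r → x ∷ r ↭ xs → h x r ≤ h′ x r) →
               ∑pick h xs ≤ ∑pick h′ xs
  ∑pick-mono []       h≤h′ = ≤.refl
  ∑pick-mono (x ∷ xs) h≤h′ = +-mono-≤ (h≤h′ x xs ↭.refl)
    (∑pick-mono xs λ y r p → h≤h′ y (x ∷ r) (↭.trans (↭.swap y x ↭.refl) (↭.prep x p)))

  ∑pick-cong : ∀ {h h′} xs → (∀ x r → x ∷ r ↭ xs → h x r ≈ h′ x r) →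
               ∑pick h xs ≈ ∑pick h′ xs
  ∑pick-cong xs h≈h′ = ≤.antisym
    (∑pick-mono xs λ x r p → ≤.reflexive (h≈h′ x r p))
    (∑pick-mono xs λ x r p → ≤.reflexive (sym (h≈h′ x r p)))

  ∑pick-+ : ∀ g h xs → ∑pick (λ x r → g x r + h x r) xs ≈ ∑pick g xs + ∑pick h xs
  ∑pick-+ g h []       = sym (+-identityˡ 0#)
  ∑pick-+ g h (x ∷ xs) = trans (+-congˡ (∑pick-+ _ _ xs))
    (solve 4 (λ a b c d → (a :+ b) :+ (c :+ d) := (a :+ c) :+ (b :+ d)) refl _ _ _ _)

  ∑pick-*ˡ : ∀ c h xs → ∑pick (λ x r → c * h x r) xs ≈ c * ∑pick h xs
  ∑pick-*ˡ c h []       = sym (zeroʳ c)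
  ∑pick-*ˡ c h (x ∷ xs) = trans (+-congˡ (∑pick-*ˡ c _ xs)) (sym (distribˡ c _ _))

  ∑pick-const : ∀ c xs → ∑pick (λ _ _ → c) xs ≈ fromℕ (length xs) * c
  ∑pick-const c []       = sym (zeroˡ c)
  ∑pick-const c (x ∷ xs) = trans (+-congˡ (∑pick-const c xs))
    (solve 2 (λ c n → c :+ n :* c := (con 1 :+ n) :* c) refl c _)

  ∑pick-sum : ∀ {n} (c : A → Fin n → Carrier) (w : Fin n → Carrier) xs →
    ∑pick (λ x _ → sum λ i → c x i * w i) xs ≈ sum λ i → ∑pick (λ x _ → c x i) xs * w i
  ∑pick-sum {zero}  c w xs = trans (∑pick-const 0# xs) (zeroʳ _)
  ∑pick-sum {suc n} c w xs = begin-equality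
    ∑pick (λ x _ → c x zero * w zero + sum λ i → c x (suc i) * w (suc i)) xs
      ≈⟨ ∑pick-+ _ _ xs ⟩
    ∑pick (λ x _ → c x zero * w zero) xs + ∑pick (λ x _ → sum λ i → c x (suc i) * w (suc i)) xs
      ≈⟨ +-cong
           (trans (∑pick-cong xs λ x r _ → *-comm _ _) (trans (∑pick-*ˡ (w zero) _ xs) (*-comm _ _)))
           (∑pick-sum (λ x i → c x (suc i)) (λ i → w (suc i)) xs) ⟩
    (sum λ i → ∑pick (λ x _ → c x i) xs * w i) ∎

  -- Permuted lists offer the same picks, but the remainders agree only up to permutation; hence the
  -- condition on `h`.
  ∑pick-↭ : ∀ {h} → (∀ x {r s} → r ↭ s → h x r ≈ h x s) →
            ∀ {xs ys} → xs ↭ ys → ∑pick h xs ≈ ∑pick h ys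
  ∑pick-↭ resp ↭.refl        = refl
  ∑pick-↭ resp (↭.prep x p)  =
    +-cong (resp x p) (∑pick-↭ (λ y q → resp y (↭.prep x q)) p)
  ∑pick-↭ {h} resp (↭.swap {xs} {ys} x y p) = begin-equality
    h x (y ∷ xs) + (h y (x ∷ xs) + ∑pick (λ z r → h z (x ∷ y ∷ r)) xs)
      ≈⟨ solve 3 (λ a b c → a :+ (b :+ c) := b :+ (a :+ c)) refl _ _ _ ⟩
    h y (x ∷ xs) + (h x (y ∷ xs) + ∑pick (λ z r → h z (x ∷ y ∷ r)) xs)
      ≈⟨ +-cong (resp y (↭.prep x p)) (+-cong (resp x (↭.prep y p)) (trans
           (∑pick-↭ (λ z q → resp z (↭.prep x (↭.prep y q))) p)
           (∑pick-cong ys λ z r _ → resp z (↭.swap x y ↭.refl)))) ⟩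
    h y (x ∷ ys) + (h x (y ∷ ys) + ∑pick (λ z r → h z (y ∷ x ∷ r)) ys) ∎
  ∑pick-↭ resp (↭.trans p q) = trans (∑pick-↭ resp p) (∑pick-↭ resp q)

  -- Two picks in succession are an ordered pair of distinct positions. In the induction `u`
  -- collects the pairs with `x` at the head `z`, and `v` those with `y` there.
  ∑pick-comm : ∀ (h : A → A → List A → Carrier) xs →
    ∑pick (λ x r → ∑pick (λ y s → h x y s) r) xs ≈
    ∑pick (λ y r → ∑pick (λ x s → h x y s) r) xs
  ∑pick-comm h []       = refl
  ∑pick-comm h (z ∷ xs) = begin-equality
    u + ∑pick (λ x r → h x z r + ∑pick (λ y s → h x y (z ∷ s)) r) xs
      ≈⟨ +-congˡ (∑pick-+ _ _ xs) ⟩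
    u + (v + ∑pick (λ x r → ∑pick (λ y s → h x y (z ∷ s)) r) xs)
      ≈⟨ +-congˡ (+-congˡ (∑pick-comm (λ x y s → h x y (z ∷ s)) xs)) ⟩
    u + (v + ∑pick (λ y r → ∑pick (λ x s → h x y (z ∷ s)) r) xs)
      ≈⟨ solve 3 (λ a b c → a :+ (b :+ c) := b :+ (a :+ c)) refl _ _ _ ⟩
    v + (u + ∑pick (λ y r → ∑pick (λ x s → h x y (z ∷ s)) r) xs)
      ≈⟨ +-congˡ (∑pick-+ _ _ xs) ⟨
    v + ∑pick (λ y r → h z y r + ∑pick (λ x s → h x y (z ∷ s)) r) xs ∎
    where
    u = ∑pick (λ y r → h z y r) xs
    v = ∑pick (λ x r → h x z r) xs

  -- The sum of f over the ordered selections of t positions of xs. The head of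
  -- a selection is the latest arrival, so the recursion conditions on it.
  ∑sel : ℕ → List A → (List A → Carrier) → Carrier
  ∑sel zero    xs f = f []
  ∑sel (suc t) xs f = ∑pick (λ x r → ∑sel t r λ τ → f (x ∷ τ)) xs

  ∑sel-mono : ∀ t xs {f g} → (∀ τ → f τ ≤ g τ) → ∑sel t xs f ≤ ∑sel t xs g
  ∑sel-mono zero    xs f≤g = f≤g []
  ∑sel-mono (suc t) xs f≤g =
    ∑pick-mono xs λ x r _ → ∑sel-mono t r λ τ → f≤g (x ∷ τ)

  ∑sel-cong : ∀ t xs {f g} → (∀ τ → f τ ≈ g τ) → ∑sel t xs f ≈ ∑sel t xs g
  ∑sel-cong t xs f≈g = ≤.antisym
    (∑sel-mono t xs λ τ → ≤.reflexive (f≈g τ))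
    (∑sel-mono t xs λ τ → ≤.reflexive (sym (f≈g τ)))

  ∑sel-+ : ∀ t xs f g → ∑sel t xs (λ τ → f τ + g τ) ≈ ∑sel t xs f + ∑sel t xs g
  ∑sel-+ zero    xs f g = refl
  ∑sel-+ (suc t) xs f g =
    trans (∑pick-cong xs λ x r _ → ∑sel-+ t r _ _) (∑pick-+ _ _ xs)

  ∑sel-*ˡ : ∀ t xs c f → ∑sel t xs (λ τ → c * f τ) ≈ c * ∑sel t xs f
  ∑sel-*ˡ zero    xs c f = refl
  ∑sel-*ˡ (suc t) xs c f =
    trans (∑pick-cong xs λ x r _ → ∑sel-*ˡ t r c _) (∑pick-*ˡ c _ xs)

  ∑sel-zero : ∀ t xs → ∑sel t xs (λ _ → 0#) ≈ 0#
  ∑sel-zero t xs = begin-equality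
    ∑sel t xs (λ _ → 0#)         ≈⟨ ∑sel-cong t xs (λ _ → zeroˡ 0#) ⟨
    ∑sel t xs (λ _ → 0# * 0#)    ≈⟨ ∑sel-*ˡ t xs 0# _ ⟩
    0# * ∑sel t xs (λ _ → 0#)    ≈⟨ zeroˡ _ ⟩
    0#                           ∎

  ∑sel-nonNegative : ∀ t xs {f} → (∀ τ → 0# ≤ f τ) → 0# ≤ ∑sel t xs f
  ∑sel-nonNegative t xs 0≤f =
    ≤.trans (≤.reflexive (sym (∑sel-zero t xs))) (∑sel-mono t xs 0≤f)

  ∑sel-sum : ∀ {n} t xs (c : Fin n → Carrier) (f : Fin n → List A → Carrier) →
    ∑sel t xs (λ τ → sum λ i → c i * f i τ) ≈ sum λ i → c i * ∑sel t xs (f i)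
  ∑sel-sum {zero}  t xs c f = ∑sel-zero t xs
  ∑sel-sum {suc n} t xs c f = trans (∑sel-+ t xs _ _)
    (+-cong (∑sel-*ˡ t xs _ _) (∑sel-sum t xs (λ i → c (suc i)) (λ i → f (suc i))))

  ∑sel-↭ : ∀ t {xs ys} f → xs ↭ ys → ∑sel t xs f ≈ ∑sel t ys f
  ∑sel-↭ zero    f p = refl
  ∑sel-↭ (suc t) f p = ∑pick-↭ (λ x q → ∑sel-↭ t _ q) p

  -- Counting selections.

  -- The falling factorial `n (n - 1) ... (n - t + 1)`, the number of ordered selections of `t` out
  -- of `n` positions. It is 0 for `t > n`, because a factor `fromℕ 0` occurs.
  falling : ℕ → ℕ → Carrier
  falling zero    n = 1#
  falling (suc t) n = fromℕ n * falling t (ℕ.pred n)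

  -- The definition splits off the largest factor; induction on the number of arrivals needs the
  -- smallest one. Truncated subtraction is harmless, as both sides vanish for `t ≥ n`.
  falling-suc : ∀ t n → falling (suc t) n ≈ fromℕ (n ℕ.∸ t) * falling t n
  falling-suc zero    n       = refl
  falling-suc (suc t) zero    = trans (zeroˡ _) (sym (zeroˡ _))
  falling-suc (suc t) (suc n) = begin-equality
    fromℕ (suc n) * falling (suc t) n
      ≈⟨ *-congˡ (falling-suc t n) ⟩
    fromℕ (suc n) * (fromℕ (n ℕ.∸ t) * falling t n)
      ≈⟨ solve 3 (λ a b c → a :* (b :* c) := b :* (a :* c)) refl _ _ _ ⟩
    fromℕ (n ℕ.∸ t) * (fromℕ (suc n) * falling t n) ∎

  falling-positive : ∀ n → 0# < falling n n
  falling-positive zero    = 1≤x⇒0<x ≤.refl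
  falling-positive (suc n) = *-positive (fromℕ-positive (suc n)) (falling-positive n)

  rest-length : ∀ {x : A} {r xs} → x ∷ r ↭ xs → length r ≡ ℕ.pred (length xs)
  rest-length p = ≡.cong ℕ.pred (↭-length p)

  ∑sel-const : ∀ t xs c → ∑sel t xs (λ _ → c) ≈ falling t (length xs) * c
  ∑sel-const zero    xs c = sym (*-identityˡ c)
  ∑sel-const (suc t) xs c = begin-equality
    ∑pick (λ _ r → ∑sel t r λ _ → c) xs
      ≈⟨ ∑pick-cong xs (λ x r p → trans (∑sel-const t r c)
           (*-congʳ (reflexive (≡.cong (falling t) (rest-length p))))) ⟩
    ∑pick (λ _ _ → falling t (ℕ.pred (length xs)) * c) xs
      ≈⟨ ∑pick-const _ xs ⟩
    fromℕ (length xs) * (falling t (ℕ.pred (length xs)) * c)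
      ≈⟨ *-assoc _ _ c ⟨
    falling (suc t) (length xs) * c ∎

  -- Picking an element first and then selecting from the rest amounts to selecting first and then
  -- choosing one of the `length xs - t` positions left over.
  ∑pick-∑sel : ∀ t xs f →
    ∑pick (λ _ r → ∑sel t r f) xs ≈ fromℕ (length xs ℕ.∸ t) * ∑sel t xs f
  ∑pick-∑sel zero    xs f = ∑pick-const (f []) xs
  ∑pick-∑sel (suc t) xs f = begin-equality
    ∑pick (λ _ r → ∑pick (λ y s → ∑sel t s λ τ → f (y ∷ τ)) r) xs
      ≈⟨ ∑pick-comm (λ _ y s → ∑sel t s λ τ → f (y ∷ τ)) xs ⟩
    ∑pick (λ y r → ∑pick (λ _ s → ∑sel t s λ τ → f (y ∷ τ)) r) xs
      ≈⟨ ∑pick-cong xs (λ y r p → trans (∑pick-∑sel t r _) (*-congʳ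
           (reflexive (≡.cong fromℕ (≡.trans (≡.cong (ℕ._∸ t) (rest-length p))
             (ℕ.∸-+-assoc (length xs) 1 t)))))) ⟩
    ∑pick (λ y r → fromℕ (length xs ℕ.∸ suc t) * ∑sel t r λ τ → f (y ∷ τ)) xs
      ≈⟨ ∑pick-*ˡ _ _ xs ⟩
    fromℕ (length xs ℕ.∸ suc t) * ∑sel (suc t) xs f ∎

  -- Inserting an arrival into a selection.

  -- Lists have the latest arrival first, so `τ` is the past of `x` and `π` is what arrives after
  -- it.
  InsertionMonotone : (List A → Carrier) → Set
  InsertionMonotone f = ∀ π x τ → f (π ++ τ) ≤ f (π ++ x ∷ τ)

  -- From a selection of `t + 1` elements of `x ∷ r`, delete `x` if it occurs and the earliest
  -- arrival otherwise. Each selection of `t` elements of `r` is reached `1 + length r` times, and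
  -- deletion does not increase `f`. In terms of means: `t` arrivals without `x` in the pool yield
  -- at most what `t + 1` arrivals from the full pool do.
  ∑sel-insert : ∀ t x r {f} → InsertionMonotone f →
    fromℕ (suc (length r)) * ∑sel t r f ≤ ∑sel (suc t) (x ∷ r) f
  ∑sel-insert zero x r {f} mono = begin
    fromℕ (length (x ∷ r)) * f []  ≈⟨ ∑pick-const (f []) (x ∷ r) ⟨
    ∑pick (λ _ _ → f []) (x ∷ r)   ≤⟨ ∑pick-mono (x ∷ r) (λ y _ _ → mono [] y []) ⟩
    ∑pick (λ y _ → f (y ∷ [])) (x ∷ r) ∎
  ∑sel-insert (suc t) x r {f} mono = begin
    fromℕ (suc (length r)) * ∑sel (suc t) r f
      ≈⟨ solve 2 (λ n s → (con 1 :+ n) :* s := s :+ n :* s) refl _ _ ⟩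
    ∑sel (suc t) r f + fromℕ (length r) * ∑sel (suc t) r f
      ≈⟨ +-congˡ (∑pick-*ˡ _ _ r) ⟨
    ∑sel (suc t) r f + ∑pick (λ y s → fromℕ (length r) * ∑sel t s λ τ → f (y ∷ τ)) r
      ≤⟨ +-mono-≤ (∑sel-mono (suc t) r λ τ → mono [] x τ)
           (∑pick-mono r λ y s p → ≤.trans
             (≤.reflexive (*-congʳ (reflexive (≡.cong fromℕ (≡.sym (↭-length p))))))
             (∑sel-insert t x s λ π → mono (y ∷ π))) ⟩
    ∑sel (suc (suc t)) (x ∷ r) f ∎

  InsertionInvariant : A → (List A → Carrier) → Set
  InsertionInvariant x f = ∀ π τ → f (π ++ x ∷ τ) ≈ f (π ++ τ)

  -- A full ordering of `r` extends to one of `x ∷ r` by placing `x` in any of `n + 1` positions,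
  -- and none of them changes `f`.
  ∑sel-invariant : ∀ n x r {f} → InsertionInvariant x f → length r ≡ n →
    ∑sel (suc n) (x ∷ r) f ≈ fromℕ (suc n) * ∑sel n r f
  ∑sel-invariant zero    x [] {f} inv _ = trans (+-congʳ (inv [] []))
    (solve 1 (λ a → a :+ con 0 := (con 1 :+ con 0) :* a) refl (f []))
  ∑sel-invariant (suc n) x r {f} inv eq = begin-equality
    ∑sel (suc n) r (λ τ → f (x ∷ τ)) + ∑pick (λ y s → ∑sel (suc n) (x ∷ s) λ τ → f (y ∷ τ)) r
      ≈⟨ +-cong (∑sel-cong (suc n) r (inv []))
           (∑pick-cong r λ y s p → ∑sel-invariant n x s (λ π → inv (y ∷ π))
             (≡.trans (rest-length p) (≡.cong ℕ.pred eq))) ⟩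
    ∑sel (suc n) r f + ∑pick (λ y s → fromℕ (suc n) * ∑sel n s λ τ → f (y ∷ τ)) r
      ≈⟨ +-congˡ (∑pick-*ˡ _ _ r) ⟩
    ∑sel (suc n) r f + fromℕ (suc n) * ∑sel (suc n) r f
      ≈⟨ solve 2 (λ n s → s :+ n :* s := (con 1 :+ n) :* s) refl _ _ ⟩
    fromℕ (suc (suc n)) * ∑sel (suc n) r f ∎

  -- Sums over permutations as sums over full selections.

  ∑list : ∀ {B : Set} → (B → Carrier) → List B → Carrier
  ∑list f xs = foldr _+_ 0# (map f xs)

  ∑list-++ : ∀ {B : Set} (f : B → Carrier) xs ys →
             ∑list f (xs ++ ys) ≈ ∑list f xs + ∑list f ys
  ∑list-++ f []       ys = sym (+-identityˡ _)
  ∑list-++ f (x ∷ xs) ys = trans (+-congˡ (∑list-++ f xs ys)) (sym (+-assoc _ _ _))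

  ∑list-concatMap : ∀ {B C : Set} (f : C → Carrier) (g : B → List C) xs →
                    ∑list f (concatMap g xs) ≈ ∑list (λ x → ∑list f (g x)) xs
  ∑list-concatMap f g []       = refl
  ∑list-concatMap f g (x ∷ xs) =
    trans (∑list-++ f (g x) _) (+-congˡ (∑list-concatMap f g xs))

  ∑pick-tabulate : ∀ {n} (w : A → Carrier) (g : Fin n → A) →
                   ∑pick (λ x _ → w x) (tabulate g) ≡ sum λ i → w (g i)
  ∑pick-tabulate {zero}  w g = ≡.refl
  ∑pick-tabulate {suc n} w g = ≡.cong (w (g zero) +_) (∑pick-tabulate w λ i → g (suc i))

  -- `permutations` recurses on the input and inserts its head anywhere, whereas `∑sel` recurses on
  -- the output and picks its head. The induction reconciles them by splitting on whether `x` heads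
  -- the output.
  ∑sel-insertions : ∀ n x xs f → length xs ≡ n →
    ∑sel (suc n) (x ∷ xs) f ≈ ∑sel n xs (λ τ → ∑list f (insertions x τ))
  ∑sel-insertions zero    x [] f _  = refl
  ∑sel-insertions (suc n) x xs f eq = begin-equality
    ∑sel (suc n) xs (λ τ → f (x ∷ τ)) + ∑pick (λ z r → ∑sel (suc n) (x ∷ r) λ τ → f (z ∷ τ)) xs
      ≈⟨ +-congˡ (∑pick-cong xs λ z r p → trans
           (∑sel-insertions n x r _ (≡.trans (rest-length p) (≡.cong ℕ.pred eq)))
           (∑sel-cong n r λ τ → reflexive (≡.cong (foldr _+_ 0#) (map-∘ (insertions x τ))))) ⟩
    ∑sel (suc n) xs (λ τ → f (x ∷ τ)) +
      ∑pick (λ z r → ∑sel n r λ τ → ∑list f (map (z ∷_) (insertions x τ))) xs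
      ≈⟨ ∑pick-+ _ _ xs ⟨
    ∑pick (λ z r → ∑sel n r (λ τ → f (x ∷ z ∷ τ)) +
      ∑sel n r (λ τ → ∑list f (map (z ∷_) (insertions x τ)))) xs
      ≈⟨ ∑pick-cong xs (λ z r _ → ∑sel-+ n r _ _) ⟨
    ∑sel (suc n) xs (λ τ → ∑list f (insertions x τ)) ∎

  ∑list-permutations : ∀ xs f → ∑list f (permutations xs) ≈ ∑sel (length xs) xs f
  ∑list-permutations []       f = +-identityʳ (f [])
  ∑list-permutations (x ∷ xs) f = begin-equality
    ∑list f (concatMap (insertions x) (permutations xs))
      ≈⟨ ∑list-concatMap f (insertions x) (permutations xs) ⟩
    ∑list (λ τ → ∑list f (insertions x τ)) (permutations xs)
      ≈⟨ ∑list-permutations xs _ ⟩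
    ∑sel (length xs) xs (λ τ → ∑list f (insertions x τ))
      ≈⟨ ∑sel-insertions (length xs) x xs f ≡.refl ⟨
    ∑sel (suc (length xs)) (x ∷ xs) f ∎

  -- As a sum of ones, the number of orders can be evaluated through selections.
  fromℕ-length : ∀ {B : Set} (xs : List B) → fromℕ (length xs) ≈ ∑list (λ _ → 1#) xs
  fromℕ-length []       = refl
  fromℕ-length (x ∷ xs) = +-congˡ (fromℕ-length xs)

-- Selections from the image of a list.

module _ (ℝ : CompleteOrderedField) {A B : Set} (g : A → B) where
  open CompleteOrderedField ℝ hiding (zero)
  open Selections ℝ

  ∑pick-map : ∀ h xs → ∑pick h (map g xs) ≡ ∑pick (λ x r → h (g x) (map g r)) xs
  ∑pick-map h []       = ≡.refl
  ∑pick-map h (x ∷ xs) = ≡.cong (h (g x) (map g xs) +_) (∑pick-map _ xs)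

  ∑sel-map : ∀ t xs f → ∑sel t (map g xs) f ≈ ∑sel t xs (λ τ → f (map g τ))
  ∑sel-map zero    xs f = refl
  ∑sel-map (suc t) xs f = trans (reflexive (∑pick-map _ xs))
    (∑pick-cong xs λ x r _ → ∑sel-map t r _)

-- The recursion for the mean value in random order.

module RandomOrder (ℝ : CompleteOrderedField) {J : Set} {k : ℕ} where
  open CompleteOrderedField ℝ hiding (zero)
  open Selections ℝ {J}
  open OrderedField ℝ
  open Algebra.Properties.Semiring.Sum semiring
    using (*-distribˡ-sum)
  open Algebra.Properties.Semiring.Exp semiring using (_^_)
  open Algebra.Solver.Ring.NaturalCoefficients.Default commutativeSemiring
    using (solve; _:+_; _:*_; _:=_; con)
  open Relation.Binary.Reasoning.PartialOrder poset

  -- Here `Φ` stands for the achieved value, `gain` for its increase at an arrival, `load` for the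
  -- spent fraction of each budget `B`, and `c` for what the comparison allocation spends on each
  -- buyer. The algorithm enters only through the conditions listed.
  module Bound
    (xs : List J) (Φ : List J → Carrier) (gain : J → List J → Carrier)
    (load : Fin k → List J → Carrier) (c : J → Fin k → Carrier) (B : Fin k → Carrier)
    (Φ[]≥0 : 0# ≤ Φ [])
    (Φ-∷ : ∀ j τ → Φ (j ∷ τ) ≈ Φ τ + gain j τ)
    (Φ-load : ∀ τ → Φ τ ≈ sum λ i → B i * load i τ)
    (load≥0 : ∀ i τ → 0# ≤ load i τ)
    (load-mono : ∀ i → InsertionMonotone (load i))
    (c≥0 : ∀ j i → 0# ≤ c j i)
    (c≤B : ∀ i → ∑pick (λ j _ → c j i) xs ≤ B i)
    (c≤gain+c*load : ∀ j τ → sum (c j) ≤ gain j τ + sum λ i → c j i * load i τ)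
    where

    private
      n = length xs
      N = fromℕ n
      M = fromℕ (suc n)

    -- The value of the comparison allocation, which need not be optimal.
    opt : Carrier
    opt = ∑pick (λ j _ → sum (c j)) xs

    -- Kept as a sum to avoid division: for `t ≤ n`, the mean after `t` arrivals is this divided by
    -- `falling t n`.
    ∑Φ : ℕ → Carrier
    ∑Φ t = ∑sel t xs Φ

    ∑gain : ℕ → Carrier
    ∑gain t = ∑pick (λ j r → ∑sel t r (gain j)) xs

    ∑Φ-suc : ∀ t → ∑Φ (suc t) ≈ fromℕ (n ℕ.∸ t) * ∑Φ t + ∑gain t
    ∑Φ-suc t = begin-equality
      ∑pick (λ j r → ∑sel t r λ τ → Φ (j ∷ τ)) xs
        ≈⟨ ∑pick-cong xs (λ j r _ → trans (∑sel-cong t r (Φ-∷ j)) (∑sel-+ t r _ _)) ⟩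
      ∑pick (λ j r → ∑sel t r Φ + ∑sel t r (gain j)) xs
        ≈⟨ ∑pick-+ _ _ xs ⟩
      ∑pick (λ _ r → ∑sel t r Φ) xs + ∑gain t
        ≈⟨ +-congʳ (∑pick-∑sel t xs Φ) ⟩
      fromℕ (n ℕ.∸ t) * ∑Φ t + ∑gain t ∎

    -- The levels just before `j` come from `t` arrivals out of the pool `r` without `j`.
    -- `∑sel-insert` bounds their sum by one over `t + 1` arrivals out of the whole pool, which no
    -- longer depends on `j`.
    ∑gain-item : ∀ t j r → j ∷ r ↭ xs →
      falling (suc t) n * sum (c j) ≤
      N * ∑sel t r (gain j) + sum λ i → c j i * ∑sel (suc t) xs (load i)
    ∑gain-item t j r p = begin
      N * falling t (ℕ.pred n) * sum (c j)
        ≈⟨ *-congʳ (*-congˡ (reflexive (≡.cong (falling t) (rest-length p)))) ⟨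
      N * falling t (length r) * sum (c j)
        ≈⟨ *-assoc _ _ _ ⟩
      N * (falling t (length r) * sum (c j))
        ≈⟨ *-congˡ (∑sel-const t r _) ⟨
      N * ∑sel t r (λ _ → sum (c j))
        ≤⟨ *-monoʳ-≤ (fromℕ-nonNegative n) (∑sel-mono t r (c≤gain+c*load j)) ⟩
      N * ∑sel t r (λ τ → gain j τ + sum λ i → c j i * load i τ)
        ≈⟨ *-congˡ (trans (∑sel-+ t r _ _) (+-congˡ (∑sel-sum t r (c j) load))) ⟩
      N * (∑sel t r (gain j) + sum λ i → c j i * ∑sel t r (load i))
        ≈⟨ trans (distribˡ _ _ _) (+-congˡ
             (*-distribˡ-sum N λ i → c j i * ∑sel t r (load i))) ⟩
      N * ∑sel t r (gain j) + sum (λ i → N * (c j i * ∑sel t r (load i)))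
        ≤⟨ +-monoʳ-≤ _ (sum-mono λ i → begin
             N * (c j i * ∑sel t r (load i))
               ≈⟨ solve 3 (λ a b s → a :* (b :* s) := b :* (a :* s)) refl _ _ _ ⟩
             c j i * (N * ∑sel t r (load i))
               ≈⟨ *-congˡ (*-congʳ (reflexive (≡.cong fromℕ (↭-length p)))) ⟨
             c j i * (fromℕ (length (j ∷ r)) * ∑sel t r (load i))
               ≤⟨ *-monoʳ-≤ (c≥0 j i) (∑sel-insert t j r (load-mono i)) ⟩
             c j i * ∑sel (suc t) (j ∷ r) (load i)
               ≈⟨ *-congˡ (∑sel-↭ (suc t) (load i) p) ⟩
             c j i * ∑sel (suc t) xs (load i) ∎) ⟩
      N * ∑sel t r (gain j) + sum (λ i → c j i * ∑sel (suc t) xs (load i)) ∎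

    -- As the load sums are now the same for all items, the spending on each buyer can be collected
    -- first; it is at most `B i`, and the loads weighted by `B` add up to `Φ`.
    ∑gain-total : ∀ t → falling (suc t) n * opt ≤ N * ∑gain t + ∑Φ (suc t)
    ∑gain-total t = begin
      falling (suc t) n * opt
        ≈⟨ ∑pick-*ˡ _ _ xs ⟨
      ∑pick (λ j _ → falling (suc t) n * sum (c j)) xs
        ≤⟨ ∑pick-mono xs (∑gain-item t) ⟩
      ∑pick (λ j r → N * ∑sel t r (gain j) + sum λ i → c j i * ∑load i) xs
        ≈⟨ trans (∑pick-+ _ _ xs) (+-cong (∑pick-*ˡ N _ xs) (∑pick-sum c ∑load xs)) ⟩
      N * ∑gain t + (sum λ i → ∑pick (λ j _ → c j i) xs * ∑load i)
        ≤⟨ +-monoʳ-≤ _ (sum-mono λ i →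
             *-monoˡ-≤ (∑sel-nonNegative (suc t) xs (load≥0 i)) (c≤B i)) ⟩
      N * ∑gain t + (sum λ i → B i * ∑load i)
        ≈⟨ +-congˡ (trans (∑sel-cong (suc t) xs Φ-load) (∑sel-sum (suc t) xs B load)) ⟨
      N * ∑gain t + ∑Φ (suc t) ∎
      where
      ∑load : Fin k → Carrier
      ∑load i = ∑sel (suc t) xs (load i)

    -- Divided by `falling (suc t) n`, for `t < n`, this is `v + N Y_t ≤ (N + 1) Y_{t+1}` with
    -- `v = opt`.
    ∑Φ-step : ∀ t → falling (suc t) n * opt + N * (fromℕ (n ℕ.∸ t) * ∑Φ t) ≤ M * ∑Φ (suc t)
    ∑Φ-step t = begin
      falling (suc t) n * opt + N * (fromℕ (n ℕ.∸ t) * ∑Φ t)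
        ≤⟨ +-monoˡ-≤ _ (∑gain-total t) ⟩
      N * ∑gain t + ∑Φ (suc t) + N * (fromℕ (n ℕ.∸ t) * ∑Φ t)
        ≈⟨ solve 4 (λ n g p q → n :* g :+ p :+ n :* q := n :* (q :+ g) :+ p) refl _ _ _ _ ⟩
      N * (fromℕ (n ℕ.∸ t) * ∑Φ t + ∑gain t) + ∑Φ (suc t)
        ≈⟨ +-congʳ (*-congˡ (∑Φ-suc t)) ⟨
      N * ∑Φ (suc t) + ∑Φ (suc t)
        ≈⟨ solve 2 (λ n p → n :* p :+ p := (con 1 :+ n) :* p) refl _ _ ⟩
      M * ∑Φ (suc t) ∎

    -- The deficit d_t = falling t n * opt - ∑Φ t satisfies
    -- (N + 1) d_{t+1} ≤ N (N - t) d_t; the subtraction is moved to the right.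
    ∑Φ-bound : ∀ t → M ^ t * (falling t n * opt) ≤ M ^ t * ∑Φ t + N ^ t * (falling t n * opt)
    ∑Φ-bound zero = x≤y+x _ (≤.trans Φ[]≥0 (≤.reflexive (sym (*-identityˡ _))))
    ∑Φ-bound (suc t) = begin
      M * M ^ t * X′
        ≈⟨ solve 3 (λ n m x → (con 1 :+ n) :* m :* x := m :* x :+ n :* (m :* x)) refl N (M ^ t) X′ ⟩
      M ^ t * X′ + N * (M ^ t * X′)
        ≈⟨ +-congˡ (*-congˡ (*-congˡ X′≈lX)) ⟩
      M ^ t * X′ + N * (M ^ t * (l * X))
        ≈⟨ +-congˡ (solve 4 (λ n m l x → n :* (m :* (l :* x)) := n :* l :* (m :* x)) refl N (M ^ t) l X) ⟩
      M ^ t * X′ + N * l * (M ^ t * X)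
        ≤⟨ +-monoʳ-≤ _ (*-monoʳ-≤ (*-nonNegative (fromℕ-nonNegative n) (fromℕ-nonNegative (n ℕ.∸ t))) (∑Φ-bound t)) ⟩
      M ^ t * X′ + N * l * (M ^ t * ∑Φ t + N ^ t * X)
        ≈⟨ solve 7 (λ m x′ n l p n^t x → m :* x′ :+ n :* l :* (m :* p :+ n^t :* x) :=
             m :* (x′ :+ n :* (l :* p)) :+ n :* n^t :* (l :* x)) refl (M ^ t) X′ N l (∑Φ t) (N ^ t) X ⟩
      M ^ t * (X′ + N * (l * ∑Φ t)) + N * N ^ t * (l * X)
        ≤⟨ +-mono-≤ (*-monoʳ-≤ (^-nonNegative t (fromℕ-nonNegative (suc n))) (∑Φ-step t))
             (≤.reflexive (*-congˡ (sym X′≈lX))) ⟩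
      M ^ t * (M * ∑Φ (suc t)) + N ^ suc t * X′
        ≈⟨ +-congʳ (solve 3 (λ a b c → a :* (b :* c) := b :* a :* c) refl (M ^ t) M (∑Φ (suc t))) ⟩
      M ^ suc t * ∑Φ (suc t) + N ^ suc t * X′ ∎
      where
      l = fromℕ (n ℕ.∸ t)
      X = falling t n * opt
      X′ = falling (suc t) n * opt
      X′≈lX : X′ ≈ l * X
      X′≈lX = trans (*-congʳ (falling-suc t n)) (*-assoc _ _ _)

-- Charging a single arrival under greedy allocation.

module GreedyAnalysis (ℝ : CompleteOrderedField) (L : OnBAP.Buyers ℝ) where
  open CompleteOrderedField ℝ hiding (zero)
  open OrderedField ℝ
  open OnBAP ℝ
  open Buyers L
  open Algebra.Properties.Semiring.Sum semiring
    using (sum-cong-≋; ∑-distrib-+; *-distribˡ-sum)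
  open Algebra.Solver.Ring.NaturalCoefficients.Default commutativeSemiring
    using (solve; _:+_; _:*_; _:=_)
  open Relation.Binary.Reasoning.PartialOrder poset

  onEdge-mono : ∀ j i {u w} → (i ∈ neighbours j → u ≤ w) → onEdge L j i u ≤ onEdge L j i w
  onEdge-mono j i u≤w with lookup (neighbours j) i in eq
  ... | inside  = u≤w (lookup⇒[]= i (neighbours j) eq)
  ... | outside = ≤.refl

  onEdge-∈ : ∀ {j i} u → i ∈ neighbours j → onEdge L j i u ≡ u
  onEdge-∈ u i∈N = ≡.cong (if_then u else 0#) ([]=⇒lookup i∈N)

  onEdge-0 : ∀ j i → onEdge L j i 0# ≡ 0#
  onEdge-0 j i with lookup (neighbours j) i
  ... | inside  = ≡.refl
  ... | outside = ≡.refl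

  onEdge-nonNegative : ∀ j i {u} → (i ∈ neighbours j → 0# ≤ u) → 0# ≤ onEdge L j i u
  onEdge-nonNegative j i 0≤u =
    ≤.trans (≤.reflexive (reflexive (≡.sym (onEdge-0 j i)))) (onEdge-mono j i 0≤u)

  onEdge-*ˡ : ∀ j i a u → a * onEdge L j i u ≈ onEdge L j i (a * u)
  onEdge-*ˡ j i a u with lookup (neighbours j) i
  ... | inside  = refl
  ... | outside = zeroʳ a

  ∑N-*ˡ : ∀ j a f → ∑N L j (λ i → a * f i) ≈ a * ∑N L j f
  ∑N-*ˡ j a f = trans (sum-cong-≋ λ i → sym (onEdge-*ˡ j i a (f i)))
    (sym (*-distribˡ-sum a λ i → onEdge L j i (f i)))

  ∑N-mono : ∀ j {f g} → (∀ i → i ∈ neighbours j → f i ≤ g i) → ∑N L j f ≤ ∑N L j g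
  ∑N-mono j f≤g = sum-mono λ i → onEdge-mono j i (f≤g i)

  ∑N-nonNegative : ∀ j {f} → (∀ i → i ∈ neighbours j → 0# ≤ f i) → 0# ≤ ∑N L j f
  ∑N-nonNegative j 0≤f = sum-nonNegative λ i → onEdge-nonNegative j i (0≤f i)

  term≤∑N : ∀ j {f} → (∀ i → i ∈ neighbours j → 0# ≤ f i) →
            ∀ {i} → i ∈ neighbours j → f i ≤ ∑N L j f
  term≤∑N j {f} 0≤f {i} i∈N = begin
    f i                 ≡⟨ onEdge-∈ {j} (f i) i∈N ⟨
    onEdge L j i (f i)  ≤⟨ term≤sum {f = λ k → onEdge L j k (f k)} (λ k → onEdge-nonNegative j k (0≤f k)) i ⟩
    ∑N L j f            ∎

  load : (Buyer L → Carrier) → Buyer L → Carrier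
  load y i = y i * budget i ⁻¹

  budget*load : ∀ y i → budget i * load y i ≈ y i
  budget*load y i = trans
    (solve 3 (λ b y β → b :* (y :* β) := b :* β :* y) refl _ _ _)
    (trans (*-congʳ (⁻¹-inverseʳ _ (<⇒≉0 (budget>0 i)))) (*-identityˡ _))

  load-mono : ∀ {y y′} i → y i ≤ y′ i → load y i ≤ load y′ i
  load-mono i y≤y′ = *-monoˡ-≤ (⁻¹-nonNegative (budget>0 i)) y≤y′

  load-nonNegative : ∀ {y} i → 0# ≤ y i → 0# ≤ load y i
  load-nonNegative i 0≤y = *-nonNegative 0≤y (⁻¹-nonNegative (budget>0 i))

  module _
    {y x : Buyer L → Carrier} {j : Item L} (process : GreedyProcess L y j x)
    (y≥0 : ∀ i → 0# ≤ y i)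
    (x≥0 : ∀ i → i ∈ neighbours j → 0# ≤ x i)
    (∑x≤1 : ∑N L j x ≤ 1#)
    (b≤B : ∀ i → i ∈ neighbours j → bid j i ≤ budget i)
    where
    open GreedyProcess process hiding (N)
    private
      gain : Carrier
      gain = ∑N L j λ i → bid j i * x i

      bx≥0 : ∀ i → i ∈ neighbours j → 0# ≤ bid j i * x i
      bx≥0 i i∈N = *-nonNegative (bid≥0 j i∈N) (x≥0 i i∈N)

    gain≥0 : 0# ≤ gain
    gain≥0 = ∑N-nonNegative j bx≥0

    total≥0 : 0# ≤ total
    total≥0 = ∑N-nonNegative j x≥0

    module _ {i : Buyer L} (i∈N : i ∈ neighbours j) where
      private
        b = bid j i
        β = budget i ⁻¹

      -- Exhaustion means that `i` itself received `b x_i = B - y`. Since `b ≤ B`, the part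
      -- `b (1 - y/B)` of the bid is at most `B - y`, and the remaining `b y/B` is the load term.
      exhausted-gain : Exhausted total i → b ≤ gain + b * load y i
      exhausted-gain exhausted = begin
        b
          ≈⟨ trans (*-congˡ (⁻¹-inverseʳ _ (<⇒≉0 (budget>0 i)))) (*-identityʳ b) ⟨
        b * (budget i * β)
          ≈⟨ *-congˡ (*-congʳ exhausted) ⟨
        b * ((y i + b * path total i) * β)
          ≈⟨ *-congˡ (*-congʳ (+-congˡ (*-congˡ (path-end i∈N)))) ⟩
        b * ((y i + b * x i) * β)
          ≈⟨ solve 4 (λ b y r β → b :* ((y :+ r) :* β) := b :* (r :* β) :+ b :* (y :* β)) refl b (y i) (b * x i) β ⟩
        b * load (λ i → bid j i * x i) i + b * load y i
          ≤⟨ +-monoˡ-≤ _ (*-monoˡ-≤ (load-nonNegative {λ i → bid j i * x i} i (bx≥0 i i∈N)) (b≤B i i∈N)) ⟩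
        budget i * load (λ i → bid j i * x i) i + b * load y i
          ≈⟨ +-congʳ (budget*load (λ i → bid j i * x i) i) ⟩
        b * x i + b * load y i
          ≤⟨ +-monoˡ-≤ _ (term≤∑N j bx≥0 i∈N) ⟩
        gain + b * load y i ∎

      -- An unexhausted neighbour rules out waste, so the whole item is allocated, and every buyer
      -- with a positive share bids at least `b`.
      unexhausted-gain : ¬ Exhausted total i → b ≤ gain
      unexhausted-gain ¬exhausted = begin
        b                         ≈⟨ *-identityʳ b ⟨
        b * 1#                    ≈⟨ *-congˡ total≈1 ⟨
        b * total                 ≈⟨ ∑N-*ˡ j b x ⟨
        ∑N L j (λ k → b * x k)    ≤⟨ ∑N-mono j best ⟩
        gain                      ∎
        where
        total≈1 : total ≈ 1#
        total≈1 with total ≤.≟ 1#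
        ... | yes total≈1 = total≈1
        ... | no  total≉1 = contradiction (no-waste (∑x≤1 , total≉1) i∈N) ¬exhausted

        0<total : 0# < total
        0<total = total≥0 , λ 0≈total → 0#≉1# (trans 0≈total total≈1)

        best : ∀ k → k ∈ neighbours j → b * x k ≤ bid j k * x k
        best k k∈N with 0# ≤.≟ x k
        ... | yes 0≈xk = ≤.reflexive (trans (vanish b) (sym (vanish (bid j k))))
          where
          vanish : ∀ a → a * x k ≈ 0#
          vanish a = trans (*-congˡ (sym 0≈xk)) (zeroʳ a)
        -- Buyer `i` is unexhausted at the end and hence was available throughout, so the
        -- maximum-bid rule can be applied to the whole clock interval from `0#` to `total`.
        ... | no 0≉xk = *-monoˡ-≤ (x≥0 k k∈N)
          (proj₂ (selects-maximum-bid k∈N ≤.refl 0<total ≤.refl grows) i∈N ¬exhausted)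
          where
          grows : path 0# k < path total k
          grows =
            (begin
              path 0# k     ≈⟨ path-start k∈N ⟩
              0#            ≤⟨ x≥0 k k∈N ⟩
              x k           ≈⟨ path-end k∈N ⟨
              path total k  ∎) ,
            λ eq → 0≉xk (trans (sym (path-start k∈N)) (trans eq (path-end k∈N)))

      bid≤gain : b ≤ gain + b * load y i
      bid≤gain with (y i + b * path total i) ≤.≟ budget i
      ... | yes exhausted = exhausted-gain exhausted
      ... | no ¬exhausted = ≤.trans (unexhausted-gain ¬exhausted)
        (x≤x+y gain (*-nonNegative (bid≥0 j i∈N) (load-nonNegative {y} i (y≥0 i))))

    -- `bid≤gain` is weighted by the shares `z i`. They sum to at most 1, so the gain is charged at
    -- most once in total.
    value≤gain : (z : Buyer L → Carrier) →
      (∀ i → i ∈ neighbours j → 0# ≤ z i) → ∑N L j z ≤ 1# →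
      ∑N L j (λ i → bid j i * z i) ≤
      gain + sum λ i → onEdge L j i (bid j i * z i) * load y i
    value≤gain z z≥0 ∑z≤1 = begin
      (sum λ i → onEdge L j i (bid j i * z i))
        ≤⟨ sum-mono charge ⟩
      (sum λ i → gain * onEdge L j i (z i) + onEdge L j i (bid j i * z i) * load y i)
        ≈⟨ ∑-distrib-+ (λ i → gain * onEdge L j i (z i)) _ ⟩
      (sum λ i → gain * onEdge L j i (z i)) + rest
        ≈⟨ +-congʳ (*-distribˡ-sum gain λ i → onEdge L j i (z i)) ⟨
      gain * ∑N L j z + rest
        ≤⟨ +-monoˡ-≤ rest (*-monoʳ-≤ gain≥0 ∑z≤1) ⟩
      gain * 1# + rest
        ≈⟨ +-congʳ (*-identityʳ gain) ⟩
      gain + rest ∎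
      where
      rest = sum λ i → onEdge L j i (bid j i * z i) * load y i

      charge : ∀ i → onEdge L j i (bid j i * z i) ≤
        gain * onEdge L j i (z i) + onEdge L j i (bid j i * z i) * load y i
      charge i with lookup (neighbours j) i in eq
      ... | outside = ≤.reflexive (sym (trans (+-cong (zeroʳ _) (zeroˡ _)) (+-identityˡ 0#)))
      ... | inside  = begin
        bid j i * z i
          ≤⟨ *-monoˡ-≤ (z≥0 i i∈N) (bid≤gain i∈N) ⟩
        (gain + bid j i * load y i) * z i
          ≈⟨ solve 4 (λ g b l z → (g :+ b :* l) :* z := g :* z :+ b :* z :* l) refl _ _ _ _ ⟩
        gain * z i + bid j i * z i * load y i ∎
        where
        i∈N : i ∈ neighbours j
        i∈N = lookup⇒[]= i (neighbours j) eq

-- Padding with isolated items and the bound for every pool size.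

module Padding (ℝ : CompleteOrderedField) (L : OnBAP.Buyers ℝ) where
  open CompleteOrderedField ℝ hiding (zero)
  open OrderedField ℝ
  open OnBAP ℝ
  open Buyers L
  open OnlineAlgorithm
  open GreedyAnalysis ℝ L
  open Algebra.Properties.Semiring.Sum semiring
    using (sum-cong-≋; ∑-distrib-+; sum-replicate-zero)
  open Algebra.Properties.Semiring.Exp semiring using (_^_)
  open Algebra.Solver.Ring.NaturalCoefficients.Default commutativeSemiring
    using (solve; _:+_; _:*_; _:=_)
  open Relation.Binary.Reasoning.PartialOrder poset

  -- Counting the value by buyers instead of by items makes it a function of the water-levels alone.
  achieved≈∑level : ∀ A seq → achieved L A seq ≈ sum (level A seq)
  achieved≈∑level A []        = sym (sum-replicate-zero size)
  achieved≈∑level A (j ∷ seq) = trans (+-congʳ (achieved≈∑level A seq))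
    (sym (∑-distrib-+ (level A seq) λ i → onEdge L j i (bid j i * allocate A seq j i)))

  level≥0 : ∀ A seq i → 0# ≤ level A seq i
  level≥0 A []        i = ≤.refl
  level≥0 A (j ∷ seq) i = +-nonNegative (level≥0 A seq i)
    (onEdge-nonNegative j i λ i∈N → *-nonNegative (bid≥0 j i∈N) (allocate≥0 A seq j i∈N))

  level≤level-∷ : ∀ A j seq → _⪯_ L (level A seq) (level A (j ∷ seq))
  level≤level-∷ A j seq i = x≤x+y _
    (onEdge-nonNegative j i λ i∈N → *-nonNegative (bid≥0 j i∈N) (allocate≥0 A seq j i∈N))

  isolated : Item L
  isolated = record { neighbours = ⊥ ; bid = λ _ → 0# ; bid≥0 = λ _ → ≤.refl }

  onEdge-isolated : ∀ i u → onEdge L isolated i u ≡ 0#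
  onEdge-isolated i u = ≡.cong (if_then u else 0#) (lookup-replicate i outside)

  module _ (A : OnlineAlgorithm L) (greedy : Greedy L A) (monotone : AllocationMonotone L A)
           {n : ℕ} (item : Instance L n) (b≤B : BidsWithinBudgets L item) where

    -- The index nothing stands for an isolated item.
    item⁺ : Maybe (Fin n) → Item L
    item⁺ = maybe item isolated

    level⁺ : List (Maybe (Fin n)) → Buyer L → Carrier
    level⁺ τ = level A (map item⁺ τ)

    achieved⁺ : List (Maybe (Fin n)) → Carrier
    achieved⁺ τ = achieved L A (map item⁺ τ)

    open Selections ℝ {Maybe (Fin n)}

    -- Allocation-monotonicity is iterated over the later arrivals `π`, which are common to both
    -- sequences.
    level⁺-++ : ∀ π {τ σ} → _⪯_ L (level⁺ τ) (level⁺ σ) → _⪯_ L (level⁺ (π ++ τ)) (level⁺ (π ++ σ))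
    level⁺-++ []      τ⪯σ = τ⪯σ
    level⁺-++ (j ∷ π) τ⪯σ = monotone _ _ (item⁺ j) (level⁺-++ π τ⪯σ)

    level⁺-monotone : ∀ i → InsertionMonotone (λ τ → level⁺ τ i)
    level⁺-monotone i π j τ = level⁺-++ π (level≤level-∷ A (item⁺ j) _) i

    -- The rule may inspect the whole past, including isolated items. But the levels agree right
    -- after the isolated arrival, and monotonicity in both directions keeps them equal from then
    -- on.
    level⁺-invariant : ∀ i → InsertionInvariant nothing (λ τ → level⁺ τ i)
    level⁺-invariant i π τ = ≤.antisym
      (level⁺-++ π (λ k → ≤.reflexive (trans (+-congˡ (reflexive (onEdge-isolated k _))) (+-identityʳ _))) i)
      (level⁺-monotone i π nothing τ)

    achieved⁺-invariant : InsertionInvariant nothing achieved⁺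
    achieved⁺-invariant π τ = begin-equality
      achieved⁺ (π ++ nothing ∷ τ)      ≈⟨ achieved≈∑level A (map item⁺ (π ++ nothing ∷ τ)) ⟩
      sum (level⁺ (π ++ nothing ∷ τ))   ≈⟨ sum-cong-≋ (λ i → level⁺-invariant i π τ) ⟩
      sum (level⁺ (π ++ τ))             ≈⟨ achieved≈∑level A (map item⁺ (π ++ τ)) ⟨
      achieved⁺ (π ++ τ)                ∎

    padded : ℕ → List (Maybe (Fin n))
    padded zero    = map just (allFin n)
    padded (suc m) = nothing ∷ padded m

    length-allFin : length (allFin n) ≡ n
    length-allFin = length-tabulate λ i → i

    length-padded : ∀ m → length (padded m) ≡ m ℕ.+ n
    length-padded zero    = ≡.trans (length-map just (allFin n)) length-allFin
    length-padded (suc m) = ≡.cong suc (length-padded m)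

    ∑pick-padded : ∀ m (w : Maybe (Fin n) → Carrier) → w nothing ≈ 0# →
                   ∑pick (λ j _ → w j) (padded m) ≈ sum λ j → w (just j)
    ∑pick-padded zero    w w≈0 = reflexive
      (≡.trans (≡.cong (∑pick λ j _ → w j) (map-tabulate (λ i → i) just)) (∑pick-tabulate w just))
    ∑pick-padded (suc m) w w≈0 =
      trans (+-cong w≈0 (∑pick-padded m w w≈0)) (+-identityˡ _)

    ∑sel-allFin : ∀ f → ∑sel n (padded 0) f ≈
                  ∑list (λ τ → f (map just τ)) (permutations (allFin n))
    ∑sel-allFin f = begin-equality
      ∑sel n (map just (allFin n)) f
        ≈⟨ ∑sel-map ℝ just n (allFin n) f ⟩
      S.∑sel n (allFin n) (λ τ → f (map just τ))
        ≡⟨ ≡.cong (λ t → S.∑sel t (allFin n) (λ τ → f (map just τ))) length-allFin ⟨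
      S.∑sel (length (allFin n)) (allFin n) (λ τ → f (map just τ))
        ≈⟨ S.∑list-permutations (allFin n) _ ⟨
      S.∑list (λ τ → f (map just τ)) (permutations (allFin n)) ∎
      where module S = Selections ℝ {Fin n}

    expected : Carrier
    expected = expectedValue L A item

    -- Each isolated item multiplies the sum and the number of orders by the same factor, so the
    -- mean stays that of the original instance.
    ∑sel-padded : ∀ m → ∑sel (m ℕ.+ n) (padded m) achieved⁺ ≈ falling (m ℕ.+ n) (m ℕ.+ n) * expected
    ∑sel-padded zero = begin-equality
      ∑sel n (padded 0) achieved⁺
        ≈⟨ ∑sel-allFin achieved⁺ ⟩
      ∑list (λ τ → achieved⁺ (map just τ)) orders
        ≡⟨ ≡.cong (foldr _+_ 0#) (map-cong (λ τ → ≡.cong (achieved L A) (≡.sym (map-∘ τ))) orders) ⟩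
      foldr _+_ 0# values
        ≈⟨ trans (*-congˡ (⁻¹-inverseʳ F (<⇒≉0 F>0))) (*-identityʳ _) ⟨
      foldr _+_ 0# values * (F * F ⁻¹)
        ≈⟨ solve 3 (λ s f i → s :* (f :* i) := f :* (s :* i)) refl _ F (F ⁻¹) ⟩
      F * (foldr _+_ 0# values * F ⁻¹)
        ≈⟨ *-cong F≈falling refl ⟩
      falling n n * expected ∎
      where
      orders = permutations (allFin n)
      values = map (λ order → achieved L A (map item order)) orders
      F = fromℕ (length values)

      -- The orders are counted by evaluating `∑sel-allFin` at the constant function 1.
      F≈falling : F ≈ falling n n
      F≈falling = begin-equality
        F                                  ≡⟨ ≡.cong fromℕ (length-map _ orders) ⟩
        fromℕ (length orders)              ≈⟨ fromℕ-length orders ⟩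
        ∑list (λ _ → 1#) orders            ≈⟨ ∑sel-allFin (λ _ → 1#) ⟨
        ∑sel n (padded 0) (λ _ → 1#)       ≈⟨ ∑sel-const n (padded 0) 1# ⟩
        falling n (length (padded 0)) * 1# ≈⟨ *-identityʳ _ ⟩
        falling n (length (padded 0))      ≡⟨ ≡.cong (falling n) (length-padded 0) ⟩
        falling n n                        ∎

      F>0 : 0# < F
      F>0 = ≤.trans (proj₁ (falling-positive n)) (≤.reflexive (sym F≈falling)) ,
        λ 0≈F → proj₂ (falling-positive n) (trans 0≈F F≈falling)
    ∑sel-padded (suc m) = begin-equality
      ∑sel (suc (m ℕ.+ n)) (nothing ∷ padded m) achieved⁺
        ≈⟨ ∑sel-invariant (m ℕ.+ n) nothing (padded m) achieved⁺-invariant (length-padded m) ⟩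
      fromℕ (suc (m ℕ.+ n)) * ∑sel (m ℕ.+ n) (padded m) achieved⁺
        ≈⟨ trans (*-congˡ (∑sel-padded m)) (sym (*-assoc _ _ _)) ⟩
      falling (suc m ℕ.+ n) (suc m ℕ.+ n) * expected ∎

    module _ {x : Buyer L → Fin n → Carrier} (feasible : Feasible L item x) where
      open Feasible feasible renaming (within-budget to x-within-budget; within-item to x-within-item)

      spend : Maybe (Fin n) → Buyer L → Carrier
      spend (just j) i = onEdge L (item j) i (bid (item j) i * x i j)
      spend nothing  i = 0#

      gain⁺ : Maybe (Fin n) → List (Maybe (Fin n)) → Carrier
      gain⁺ j τ = ∑N L (item⁺ j) λ i → bid (item⁺ j) i * allocate A (map item⁺ τ) (item⁺ j) i

      spend≥0 : ∀ j i → 0# ≤ spend j i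
      spend≥0 (just j) i = onEdge-nonNegative (item j) i λ i∈N →
        *-nonNegative (bid≥0 (item j) i∈N) (x≥0 i j i∈N)
      spend≥0 nothing  i = ≤.refl

      value≥0 : 0# ≤ value L item x
      value≥0 = sum-nonNegative λ j → sum-nonNegative (spend≥0 (just j))

      spend≤gain : ∀ j τ → sum (spend j) ≤
        gain⁺ j τ + sum λ i → spend j i * load (level⁺ τ) i
      spend≤gain (just j) τ = value≤gain
        (greedy seq (item j)) (level≥0 A seq) (λ i → allocate≥0 A seq (item j))
        (within-item A seq (item j)) (λ i → b≤B i j)
        (λ i → x i j) (λ i → x≥0 i j) (x-within-item j)
        where seq = map item⁺ τ
      spend≤gain nothing τ = begin
        (sum λ (_ : Buyer L) → 0#)
          ≈⟨ sum-replicate-zero size ⟩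
        0#
          ≤⟨ +-nonNegative
               (∑N-nonNegative isolated λ i i∈N → *-nonNegative ≤.refl (allocate≥0 A seq isolated i∈N))
               (sum-nonNegative λ i → *-nonNegative ≤.refl (load-nonNegative {level⁺ τ} i (level≥0 A seq i))) ⟩
        (gain⁺ nothing τ + sum λ i → 0# * load (level⁺ τ) i) ∎
        where seq = map item⁺ τ

      -- The recursion is run until the whole pool of `N` items has arrived; the common factor
      -- `falling N N`, which is `N!`, is then cancelled.
      bound : ∀ m → let N = m ℕ.+ n in
        fromℕ (suc N) ^ N * value L item x ≤
        fromℕ (suc N) ^ N * expected + fromℕ N ^ N * value L item x
      bound m = *-cancelˡ-≤ (falling-positive N) (begin
        f * (M^N * v)
          ≈⟨ solve 3 (λ f m v → f :* (m :* v) := m :* (f :* v)) refl f M^N v ⟩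
        M^N * (f * v)
          ≤⟨ bound′ ⟩
        M^N * ∑sel N (padded m) achieved⁺ + N^N * (f * v)
          ≈⟨ +-congʳ (*-congˡ (∑sel-padded m)) ⟩
        M^N * (f * expected) + N^N * (f * v)
          ≈⟨ solve 5 (λ f m e n v → m :* (f :* e) :+ n :* (f :* v) := f :* (m :* e :+ n :* v)) refl f M^N expected N^N v ⟩
        f * (M^N * expected + N^N * v) ∎)
        where
        N = m ℕ.+ n
        f = falling N N
        v = value L item x
        M^N = fromℕ (suc N) ^ N
        N^N = fromℕ N ^ N

        module R = RandomOrder.Bound ℝ (padded m) achieved⁺ gain⁺
          (λ i τ → load (level⁺ τ) i) spend budget
          ≤.refl
          (λ j τ → refl)
          (λ τ → trans (achieved≈∑level A (map item⁺ τ)) (sum-cong-≋ λ i → sym (budget*load (level⁺ τ) i)))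
          (λ i τ → load-nonNegative {level⁺ τ} i (level≥0 A (map item⁺ τ) i))
          (λ i π j τ → load-mono {level⁺ (π ++ τ)} {level⁺ (π ++ j ∷ τ)} i (level⁺-monotone i π j τ))
          spend≥0
          (λ i → ≤.trans (≤.reflexive (∑pick-padded m (λ j → spend j i) refl)) (x-within-budget i))
          spend≤gain

        opt≈v : R.opt ≈ v
        opt≈v = ∑pick-padded m (λ j → sum (spend j)) (sum-replicate-zero size)

        bound′ : M^N * (f * v) ≤ M^N * ∑sel N (padded m) achieved⁺ + N^N * (f * v)
        bound′ = begin
          M^N * (f * v)      ≈⟨ *-congˡ (*-congˡ opt≈v) ⟨
          -- The recursion is stated for the length of the pool, which equals `N` only
          -- propositionally, so its conclusion is transported along `length-padded`.
          M^N * (f * R.opt)  ≤⟨ ≡.subst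
            (λ l → fromℕ (suc l) ^ N * (falling N l * R.opt) ≤
                   fromℕ (suc l) ^ N * R.∑Φ N + fromℕ l ^ N * (falling N l * R.opt))
            (length-padded m) (R.∑Φ-bound N) ⟩
          M^N * R.∑Φ N + N^N * (f * R.opt)
            ≈⟨ +-congˡ (*-congˡ (*-congˡ opt≈v)) ⟩
          M^N * R.∑Φ N + N^N * (f * v) ∎

-- The competitive ratio in the random order model.

theorem5 : (ℝ : CompleteOrderedField) →
    let open CompleteOrderedField ℝ
        open Euler ℝ
        open OnBAP ℝ
    in
    (L : Buyers) (A : OnlineAlgorithm L) →
    Greedy L A →
    AllocationMonotone L A →
    ∀ {n : ℕ} (item : Instance L n) →
    BidsWithinBudgets L item →
    ∀ OPT → IsOPT L item OPT →
    ((e - 1#) * e ⁻¹) * OPT ≤ expectedValue L A item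
-- The bound holds for every feasible allocation and is applied to one that attains `OPT`.
theorem5 ℝ L A greedy monotone {n} item b≤B OPT ((x , feasible , OPT≈v) , _) =
  ≤.trans (≤.reflexive (*-congˡ OPT≈v))
    ([e-1]/e-bound n (value≥0 A greedy monotone item b≤B feasible)
      -- At least one isolated item is added, so that the pool size is positive even for `n = 0` and
      -- its powers can be cancelled.
      λ m → bound A greedy monotone item b≤B feasible (suc m))
  where
  open CompleteOrderedField ℝ
  open ExponentialBound ℝ
  open Padding ℝ L
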